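{- Let $k\geq 0$ and $t\geq 2$ be integers and let $T$ be a tournament with $n$ vertices and irregularity $i(T)\leq k$. If $n\geq 6t+5k$, then $\kappa_{s}^{*}(T)\geq t$; that is, $T$ is $\omega^{*}$-strongly connected for every $1\leq\omega\leq t$.
   Context: A tournament is a digraph in which each pair of distinct vertices is joined by exactly one arc. The irregularity $i(T)$ of a tournament $T$ is $\max_{x\in V(T)}|d^{+}(x)-d^{ - }(x)|$, where $d^{+},d^{ - }$ denote out- and in-degree. For distinct vertices $u,v$ of a digraph $D$, a strong $k^{*}$-container between $u$ and $v$ is a set of $k$ internally disjoint paths that are either all $(u,v)$-paths or all $(v,u)$-paths, whose union contains every vertex of $D$. $D$ is $k^{*}$-strongly connected if there is a strong $k^{*}$-container between every two distinct vertices of $D$. If $D$ is $1^{*}$-strongly connected, the strong spanning connectivity $\kappa_{s}^{*}(D)$ is the largest integer $k$ such that $D$ is $\omega^{*}$-strongly connected for all $1\leq\omega\leq k$. -}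

module Defs where

open import Level using (0ℓ)
open import Data.Nat using (ℕ; _≤_; ∣_-_∣)
open import Data.Fin using (Fin)
open import Data.List using (List; length; filter; map; allFin; head; last)
open import Data.List.Extrema.Nat using (max)
open import Data.List.Membership.Propositional using (_∈_)
open import Data.List.Relation.Unary.Linked using (Linked)
open import Data.List.Relation.Unary.Unique.Propositional using (Unique)
open import Data.Maybe using (just)
open import Data.Product using (_×_; ∃-syntax)
open import Data.Sum using (_⊎_)
open import Relation.Binary.Core using (Rel)
open import Relation.Binary.Definitions using (Decidable)
open import Relation.Binary.PropositionalEquality using (_≡_; _≢_)
open import Relation.Nullary using (¬_)

record Digraph (n : ℕ) : Set₁ where
  field
    _⟶_   : Rel (Fin n) 0ℓ
    _⟶?_  : Decidable _⟶_
    noLoop : ∀ {x} → ¬ (x ⟶ x)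

module _ {n : ℕ} (D : Digraph n) where
  open Digraph D

  IsTournament : Set
  IsTournament = ∀ {u v} → u ≢ v →
    ((u ⟶ v) × ¬ (v ⟶ u)) ⊎ ((v ⟶ u) × ¬ (u ⟶ v))

  outdegree : Fin n → ℕ
  outdegree x = length (filter (λ y → x ⟶? y) (allFin n))

  indegree : Fin n → ℕ
  indegree x = length (filter (λ y → y ⟶? x) (allFin n))

  -- ∣_-_∣ is the absolute difference on ℕ; the default 0 of max only
  -- matters for the empty digraph.
  irregularity : ℕ
  irregularity = max 0 (map (λ x → ∣ outdegree x - indegree x ∣) (allFin n))

  -- A (u,v)-path, represented by its sequence of vertices.
  record IsPath (u v : Fin n) (xs : List (Fin n)) : Set where
    field
      starts   : head xs ≡ just u
      ends     : last xs ≡ just v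
      arcs     : Linked _⟶_ xs
      distinct : Unique xs

  -- Since the paths form a set, they are pairwise distinct; disjoint alone
  -- would allow the one-arc path u ⟶ v to be repeated.
  record Container (k : ℕ) (u v : Fin n) : Set where
    field
      path     : Fin k → List (Fin n)
      isPath   : ∀ i → IsPath u v (path i)
      distinct : ∀ {i j} → i ≢ j → path i ≢ path j
      disjoint : ∀ {i j} → i ≢ j → ∀ {x} → x ∈ path i → x ∈ path j → x ≡ u ⊎ x ≡ v
      spanning : ∀ x → ∃[ i ] x ∈ path i

  StrongContainer : ℕ → Fin n → Fin n → Set
  StrongContainer k u v = Container k u v ⊎ Container k v u

  StronglyConnected* : ℕ → Set
  StronglyConnected* k = ∀ {u v} → u ≢ v → StrongContainer k u v

  StronglyConnected*UpTo : ℕ → Set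
  StronglyConnected*UpTo k = ∀ ω → 1 ≤ ω → ω ≤ k → StronglyConnected* ω

  -- IsStrongSpanningConnectivity κ says that κₛ*(D) is defined and equals κ.
  record IsStrongSpanningConnectivity (κ : ℕ) : Set where
    field
      connected* : StronglyConnected* 1
      attained   : StronglyConnected*UpTo κ
      largest    : ∀ k → StronglyConnected*UpTo k → k ≤ κ

{-# OPTIONS --safe #-}
module Submission where

-- For u ≢ v split the other vertices into α = N⁺u ∩ N⁺v, β = N⁻u ∩ N⁻v, γ = N⁺u ∩ N⁻v
-- and C = N⁻u ∩ N⁺v; reversing the roles of u and v we may assume ∣ C ∣ ≤ ∣ γ ∣ and look
-- for (u,v)-paths.  A system of ω disjoint (u,v)-paths whose interiors cover C always
-- extends to a spanning one: a vertex x ∈ N⁺u outside the system reaches it in at most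
-- three steps by a degree count, and then x or this short detour can be spliced into a
-- path; the case x ∈ N⁻v is dual.  To cover C:
--
-- * If 2 ∣ γ ∣ ≤ 2 ω + ∣ C ∣, a Hamiltonian path of the subtournament on C is joined to
--   u and v by routes with at most two interior vertices each, and ω - 1 further paths
--   are single vertices of γ or arcs from α to β; degree counts provide all of them.
--
-- * If 2 ∣ γ ∣ > 2 ω + ∣ C ∣, remove u, v and ω vertices of γ.  What remains is strong,
--   hence has a Hamiltonian cycle.  Let g be one of the removed vertices of γ.  Counting
--   shows that the cycle can be cut open into a path which extends to a (u,v)-path,
--   possibly using g at one of its two ends.
--
-- The exact value of κₛ* exists because containers can be searched for exhaustively.

open import Data.Bool using (true; false; if_then_else_)
open import Data.Empty using (⊥; ⊥-elim)
open import Data.Fin using (Fin; zero; suc; fromℕ<)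
open import Data.Fin.Properties using (any?; all?; injective⇒≤) renaming (_≟_ to _≟ᶠ_)
open import Data.List using (List; []; _∷_; [_]; _++_; length; filter; tabulate; allFin; concat; lookup; head; last; map; take; cartesianProductWith)
open import Data.List.Extrema.Nat using (xs≤max)
open import Data.List.Membership.Propositional using (_∈_; _∉_; find; lose)
open import Data.List.Membership.Propositional.Properties using (∈-filter⁺; ∈-filter⁻; ∈-allFin; ∈-map⁺; ∈-++⁺ˡ; ∈-++⁺ʳ; ∈-++⁻; ∈-concat⁺′; ∈-concat⁻′; ∈-lookup; ∈-cartesianProductWith⁺)
open import Data.List.Properties using (++-assoc; ++-identityʳ; ++-cancelʳ; ++-conicalˡ; ++-conicalʳ; ∷-injectiveʳ; length-++; length-++-≤ʳ; length-map; length-take; concat-map-[_]; ≡-dec)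
open import Data.List.Relation.Binary.Disjoint.Propositional using (Disjoint)
open import Data.List.Relation.Binary.Permutation.Propositional using (_↭_; ↭-refl; ↭-sym; ↭-trans; ↭-reflexive; prep; swap; ↭⇒↭ₛ)
open import Data.List.Relation.Binary.Permutation.Propositional.Properties using (∈-resp-↭; ↭-length; ++⁺ˡ; ++⁺ʳ; ++-comm; ∷↭∷ʳ; shift; shifts)
open import Data.List.Relation.Unary.All using (All; []; _∷_)
open import Data.List.Relation.Unary.AllPairs using ([]; _∷_)
open import Data.List.Relation.Unary.Any using (Any; here; there; index)
open import Data.List.Relation.Unary.Any.Properties using (lookup-index)
open import Data.List.Relation.Unary.Linked using (Linked; []; [-]; _∷_)
open import Data.List.Relation.Unary.Unique.DecPropositional using (unique?)
open import Data.List.Relation.Unary.Unique.Propositional using (Unique)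
open import Data.Maybe using (just)
open import Data.Maybe.Properties using (just-injective)
open import Data.Nat using (ℕ; zero; suc; _+_; _*_; _∸_; _≤_; _<_; _≥_; ∣_-_∣; z≤n; s≤s; s≤s⁻¹; _≤?_)
open import Data.Nat.Properties
open import Data.Nat.Tactic.RingSolver using (solve-∀)
open import Data.Product using (_×_; _,_; proj₁; proj₂; ∃-syntax)
open import Data.Sum using (_⊎_; inj₁; inj₂; [_,_]′)
open import Data.Unit using (tt)
open import Function using (_∘_; id)
open import Relation.Binary.PropositionalEquality using (_≡_; _≢_; refl; sym; trans; cong; cong₂; subst; setoid)
open import Relation.Nullary using (¬_; Dec; yes; no; does; contradiction)
open import Relation.Nullary.Decidable using (_×-dec_; _⊎-dec_; _→-dec_; ¬?; map′; toSum; decidable-stable)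
open import Relation.Unary using (Decidable)
open import Algebra.Properties.CommutativeMonoid.Sum +-0-commutativeMonoid using (sum; ∑-distrib-+; ∑-comm)
import Data.List.Membership.DecPropositional as DecMembership
import Data.List.Relation.Binary.Permutation.Setoid.Properties as Permutation
import Data.List.Relation.Unary.All as All
import Data.List.Relation.Unary.All.Properties as All
import Data.List.Relation.Unary.Any as Any
import Data.List.Relation.Unary.Any.Properties as Any
import Data.List.Relation.Unary.Linked as Linked
import Data.List.Relation.Unary.Unique.Propositional.Properties as Unique
import Data.Maybe.Properties as Maybe
open import Defs

-- The obstacle is `C`: its vertices can neither follow `u` nor precede `v`, so the splicing that
-- absorbs all other vertices has nowhere to start, and `C` must be covered beforehand.
--
-- The threshold between the two cases is dictated by counting. A Hamiltonian cycle on the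
-- `∣ α ∣ + ∣ β ∣ + (∣ γ ∣ - ω) + ∣ C ∣` remaining vertices is certain to have an arc at which it
-- can be opened once `2 (∣ γ ∣ - ω) > ∣ C ∣`. Below the threshold, `∣ C ∣ ≤ ∣ γ ∣` forces
-- `∣ C ∣ ≤ 2 ω`, so that a path through all of `C` is still short.
--
-- The bound `6 t + 5 k` has its origin in a cut estimate: if `X` and `Y` are disjoint from each
-- other and from `F`, all arcs leaving `X` end in `F` and all arcs entering `Y` start in `F`, then
-- `n ≤ 2 k + 3 ∣ F ∣`. A system that still needs an arc from `α` to `β` has at most `2 t + k`
-- interior vertices, and `2 k + 3 (2 t + k) = 6 t + 5 k`. The detours of three steps independently
-- need `n ≥ 6 + 5 k`.

-- A linear combination L ≤ R of hypotheses proves l ≤ r as soon as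
-- R - L = (r - l) - m for some m : ℕ.
linear : ∀ {L R} l r m → L ≤ R → L + r ≡ R + l + m → l ≤ r
linear {L} {R} l r m L≤R eq = +-cancelˡ-≤ R l r (begin
  R + l      ≤⟨ m≤m+n (R + l) m ⟩
  R + l + m  ≡⟨ sym eq ⟩
  L + r      ≤⟨ +-monoˡ-≤ r L≤R ⟩
  R + r      ∎)
  where open ≤-Reasoning

≤-⊥ : ∀ {L R} m → L ≤ R → L ≡ R + 1 + m → ⊥
≤-⊥ m L≤R eq = contradiction (linear 1 0 m L≤R (trans (+-identityʳ _) eq)) λ ()

-- Cardinalities of decidable vertex sets

𝟙 : ∀ {A : Set} → Dec A → ℕ
𝟙 d = if does d then 1 else 0

𝟙-yes : ∀ {A : Set} (d : Dec A) → A → 1 ≤ 𝟙 d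
𝟙-yes (yes _) _ = ≤-refl
𝟙-yes (no ¬a) a = contradiction a ¬a

sum-mono : ∀ {n} {f g : Fin n → ℕ} → (∀ i → f i ≤ g i) → sum f ≤ sum g
sum-mono {zero}  f≤g = z≤n
sum-mono {suc n} f≤g = +-mono-≤ (f≤g zero) (sum-mono (f≤g ∘ suc))

sum-mono-< : ∀ {n} {f g : Fin n → ℕ} → (∀ i → f i ≤ g i) → ∀ j → f j < g j → sum f < sum g
sum-mono-< f≤g zero    fj<gj = +-mono-<-≤ fj<gj (sum-mono (f≤g ∘ suc))
sum-mono-< f≤g (suc j) fj<gj = +-mono-≤-< (f≤g zero) (sum-mono-< (f≤g ∘ suc) j fj<gj)

record VSet (n : ℕ) : Set₁ where
  constructor ⟨_⟩
  field
    {Mem} : Fin n → Set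
    mem?  : Decidable Mem

open VSet

infix 4 _∈ˢ_ _∉ˢ_ _⊆ˢ_

_∈ˢ_ _∉ˢ_ : ∀ {n} → Fin n → VSet n → Set
x ∈ˢ S = Mem S x
x ∉ˢ S = ¬ x ∈ˢ S

_⊆ˢ_ : ∀ {n} → VSet n → VSet n → Set
S ⊆ˢ R = ∀ {x} → x ∈ˢ S → x ∈ˢ R

module _ {n : ℕ} where
  infixr 7 _∩_
  infixr 6 _∪_

  open DecMembership (_≟ᶠ_ {n}) public using (_∈?_)

  opaque
    ∣_∣ˢ : VSet n → ℕ
    ∣ S ∣ˢ = sum λ x → 𝟙 (mem? S x)

    card-sum : ∀ S → ∣ S ∣ˢ ≡ sum (𝟙 ∘ mem? S)
    card-sum S = refl

  _∩_ _∪_ : VSet n → VSet n → VSet n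
  S ∩ R = ⟨ (λ x → mem? S x ×-dec mem? R x) ⟩
  S ∪ R = ⟨ (λ x → mem? S x ⊎-dec mem? R x) ⟩

  ∁ : VSet n → VSet n
  ∁ S = ⟨ (λ x → ¬? (mem? S x)) ⟩

  ⟦_⟧ : List (Fin n) → VSet n
  ⟦ xs ⟧ = ⟨ (_∈? xs) ⟩

  ∅ : VSet n
  ∅ = ⟦ [] ⟧

  opaque
    unfolding ∣_∣ˢ

    card-cover : ∀ (S P Q : VSet n) → (∀ {x} → x ∈ˢ S → x ∈ˢ P ⊎ x ∈ˢ Q) → ∣ S ∣ˢ ≤ ∣ P ∣ˢ + ∣ Q ∣ˢ
    card-cover S P Q S⊆P∪Q = ≤-trans (sum-mono pointwise) (≤-reflexive (∑-distrib-+ (𝟙 ∘ mem? P) (𝟙 ∘ mem? Q)))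
      where
      pointwise : ∀ x → 𝟙 (mem? S x) ≤ 𝟙 (mem? P x) + 𝟙 (mem? Q x)
      pointwise x with mem? S x
      ... | no _   = z≤n
      ... | yes x∈S with S⊆P∪Q x∈S
      ...   | inj₁ x∈P = ≤-trans (𝟙-yes (mem? P x) x∈P) (m≤m+n _ _)
      ...   | inj₂ x∈Q = ≤-trans (𝟙-yes (mem? Q x) x∈Q) (m≤n+m _ _)

    card-disjoint : ∀ (P Q R : VSet n) → P ⊆ˢ R → Q ⊆ˢ R → (∀ {x} → x ∈ˢ P → x ∉ˢ Q) →
                    ∣ P ∣ˢ + ∣ Q ∣ˢ ≤ ∣ R ∣ˢ
    card-disjoint P Q R P⊆R Q⊆R P#Q = ≤-trans (≤-reflexive (sym (∑-distrib-+ (𝟙 ∘ mem? P) (𝟙 ∘ mem? Q))))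
        (sum-mono pointwise)
      where
      pointwise : ∀ x → 𝟙 (mem? P x) + 𝟙 (mem? Q x) ≤ 𝟙 (mem? R x)
      pointwise x with mem? P x | mem? Q x
      ... | yes x∈P | yes x∈Q = contradiction x∈Q (P#Q x∈P)
      ... | yes x∈P | no _    = 𝟙-yes (mem? R x) (P⊆R x∈P)
      ... | no _    | yes x∈Q = 𝟙-yes (mem? R x) (Q⊆R x∈Q)
      ... | no _    | no _    = z≤n

    card-⊆ : ∀ (P R : VSet n) → P ⊆ˢ R → ∣ P ∣ˢ ≤ ∣ R ∣ˢ
    card-⊆ P R P⊆R = sum-mono pointwise
      where
      pointwise : ∀ x → 𝟙 (mem? P x) ≤ 𝟙 (mem? R x)
      pointwise x with mem? P x
      ... | yes x∈P = 𝟙-yes (mem? R x) (P⊆R x∈P)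
      ... | no _    = z≤n

  card-∪ : ∀ (P Q : VSet n) → (∀ {x} → x ∈ˢ P → x ∉ˢ Q) → ∣ P ∣ˢ + ∣ Q ∣ˢ ≤ ∣ P ∪ Q ∣ˢ
  card-∪ P Q = card-disjoint P Q (P ∪ Q) inj₁ inj₂

card-filter : ∀ {n} {A : Set} {P : A → Set} (P? : Decidable P) (f : Fin n → A) →
              length (filter P? (tabulate f)) ≡ sum λ i → 𝟙 (P? (f i))
card-filter {zero}  P? f = refl
card-filter {suc n} P? f with does (P? (f zero))
... | true  = cong suc (card-filter P? (f ∘ suc))
... | false = card-filter P? (f ∘ suc)

sum-zero : ∀ n → sum {n} (λ _ → 0) ≡ 0
sum-zero zero    = refl
sum-zero (suc n) = sum-zero n

sum-one : ∀ n → sum {n} (λ _ → 1) ≡ n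
sum-one zero    = refl
sum-one (suc n) = cong suc (sum-one n)

sum-singleton : ∀ {n} (x : Fin n) → sum (λ y → 𝟙 (y ≟ᶠ x)) ≡ 1
sum-singleton {suc n} zero = cong suc (sum-zero n)
sum-singleton (suc x)      = sum-singleton x

module _ {n : ℕ} where

  card-singleton : ∀ (x : Fin n) → ∣ ⟨ _≟ᶠ x ⟩ ∣ˢ ≡ 1
  card-singleton x = trans (card-sum ⟨ _≟ᶠ x ⟩) (sum-singleton x)

  elements : VSet n → List (Fin n)
  elements S = filter (mem? S) (allFin n)

  length-elements : ∀ (S : VSet n) → length (elements S) ≡ ∣ S ∣ˢ
  length-elements S = trans (card-filter (mem? S) id) (sym (card-sum S))

  ∈-elements : ∀ {S : VSet n} {x} → x ∈ˢ S → x ∈ elements S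
  ∈-elements {S} x∈S = ∈-filter⁺ (mem? S) (∈-allFin _) x∈S

  elements-∈ : ∀ {S : VSet n} {x} → x ∈ elements S → x ∈ˢ S
  elements-∈ {S} x∈ = proj₂ (∈-filter⁻ (mem? S) {xs = allFin n} x∈)

  full : VSet n
  full = ⟨ (λ _ → yes tt) ⟩

  card-full : ∣ full ∣ˢ ≡ n
  card-full = trans (card-sum full) (sum-one n)

  card-≤n : ∀ (S : VSet n) → ∣ S ∣ˢ ≤ n
  card-≤n S = ≤-trans (card-⊆ S full _) (≤-reflexive card-full)

  card-empty : ∀ {S : VSet n} → (∀ {x} → x ∉ˢ S) → ∣ S ∣ˢ ≤ 0
  card-empty {S} S=∅ = ≤-trans (≤-reflexive (card-sum S))
      (≤-trans (sum-mono pointwise) (≤-reflexive (sum-zero n)))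
    where
    pointwise : ∀ x → 𝟙 (mem? S x) ≤ 0
    pointwise x with mem? S x
    ... | yes x∈S = ⊥-elim (S=∅ x∈S)
    ... | no _    = z≤n

  card-list : ∀ xs → ∣ ⟦ xs ⟧ ∣ˢ ≤ length xs
  card-list []       = card-empty {⟦ [] ⟧} λ ()
  card-list (x ∷ xs) = ≤-trans (card-cover ⟦ x ∷ xs ⟧ ⟨ _≟ᶠ x ⟩ ⟦ xs ⟧
      λ { (here e) → inj₁ e ; (there x∈) → inj₂ x∈ })
    (+-mono-≤ (≤-reflexive (card-singleton x)) (card-list xs))

  card-≤list : ∀ S xs → (∀ {x} → x ∈ˢ S → x ∈ xs) → ∣ S ∣ˢ ≤ length xs
  card-≤list S xs S⊆xs = ≤-trans (card-⊆ S ⟦ xs ⟧ S⊆xs) (card-list xs)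

  card-unique : ∀ S {xs} → Unique xs → (∀ {x} → x ∈ xs → x ∈ˢ S) → length xs ≤ ∣ S ∣ˢ
  card-unique S []              xs⊆S = z≤n
  card-unique S {x ∷ xs} (x∉ ∷ uniq) xs⊆S = ≤-trans
    (+-mono-≤ (≤-reflexive (sym (card-singleton x))) (card-unique ⟦ xs ⟧ uniq id))
    (card-disjoint ⟨ _≟ᶠ x ⟩ ⟦ xs ⟧ S (λ { refl → xs⊆S (here refl) }) (xs⊆S ∘ there)
      λ { refl y∈ → All.lookup x∉ y∈ refl })

  length-unique : ∀ {xs} → Unique xs → length xs ≤ n
  length-unique uniq = ≤-trans (card-unique full uniq _) (≤-reflexive card-full)

  card-nonempty : ∀ S → 1 ≤ ∣ S ∣ˢ → ∃[ x ] x ∈ˢ S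
  card-nonempty S 1≤ with any? (mem? S)
  ... | yes found = found
  ... | no none   = contradiction (≤-trans 1≤ (card-empty {S} λ x∈S → none (_ , x∈S))) λ ()

-- Tournaments, reversal and degrees inside a set

reverse-digraph : ∀ {n} → Digraph n → Digraph n
reverse-digraph D = record { _⟶_ = λ x y → y ⟶ x ; _⟶?_ = λ x y → y ⟶? x ; noLoop = noLoop }
  where open Digraph D

reverse-tournament : ∀ {n} (D : Digraph n) → IsTournament D → IsTournament (reverse-digraph D)
reverse-tournament D tour u≢v = tour (u≢v ∘ sym)

module Neighbours {n : ℕ} (D : Digraph n) where
  open Digraph D public

  Out In : Fin n → VSet n
  Out x = ⟨ (λ y → x ⟶? y) ⟩
  In  x = ⟨ (λ y → y ⟶? x) ⟩

  arc-≢ : ∀ {x y} → x ⟶ y → x ≢ y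
  arc-≢ x→y refl = noLoop x→y

module Tournament {n : ℕ} (D : Digraph n) (tour : IsTournament D) where
  open Neighbours D public

  asym : ∀ {x y} → x ⟶ y → ¬ y ⟶ x
  asym x→y y→x with tour (arc-≢ x→y)
  ... | inj₁ (_ , ¬y→x) = ¬y→x y→x
  ... | inj₂ (_ , ¬x→y) = ¬x→y x→y

  total : ∀ {x y} → x ≢ y → x ⟶ y ⊎ y ⟶ x
  total x≢y with tour x≢y
  ... | inj₁ (x→y , _) = inj₁ x→y
  ... | inj₂ (y→x , _) = inj₂ y→x

  connex : ∀ {x y} → x ≢ y → ¬ x ⟶ y → y ⟶ x
  connex x≢y ¬x→y with total x≢y
  ... | inj₁ x→y = contradiction x→y ¬x→y
  ... | inj₂ y→x = y→x

  degree-in : ∀ S {x} → x ∈ˢ S → suc (∣ S ∩ Out x ∣ˢ + ∣ S ∩ In x ∣ˢ) ≤ ∣ S ∣ˢ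
  degree-in S {x} x∈S = ≤-trans
    (+-mono-≤ (≤-reflexive (sym (card-singleton x)))
      (card-∪ (S ∩ Out x) (S ∩ In x) λ { (_ , x→y) (_ , y→x) → asym x→y y→x }))
    (card-disjoint ⟨ _≟ᶠ x ⟩ ((S ∩ Out x) ∪ (S ∩ In x)) S (λ { refl → x∈S })
      (λ { (inj₁ (y∈S , _)) → y∈S ; (inj₂ (y∈S , _)) → y∈S })
      λ { refl (inj₁ (_ , x→x)) → noLoop x→x ; refl (inj₂ (_ , x→x)) → noLoop x→x })

  opaque
    unfolding ∣_∣ˢ

    -- Counting the arcs inside S by their tails and by their heads, some vertex
    -- of S has at most as many out- as in-neighbours in S.
    small-outdegree : ∀ S {s} → s ∈ˢ S → ∃[ x ] (x ∈ˢ S × suc (2 * ∣ S ∩ Out x ∣ˢ) ≤ ∣ S ∣ˢ)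
    small-outdegree S {s} s∈S = result
      where
      arcs : ∀ x y → Dec ((x ∈ˢ S × y ∈ˢ S) × x ⟶ y)
      arcs x y = (mem? S x ×-dec mem? S y) ×-dec (x ⟶? y)
      outs ins : Fin n → ℕ
      outs x = sum λ y → 𝟙 (arcs x y)
      ins  x = sum λ y → 𝟙 (arcs y x)
      balanced : Dec (∃[ x ] (x ∈ˢ S × outs x ≤ ins x))
      balanced = any? λ x → mem? S x ×-dec (outs x ≤? ins x)
      out≤ : ∀ {x} → x ∈ˢ S → ∣ S ∩ Out x ∣ˢ ≤ outs x
      out≤ {x} x∈S = card-⊆ (S ∩ Out x) ⟨ arcs x ⟩ λ { (y∈S , x→y) → (x∈S , y∈S) , x→y }
      in≥ : ∀ {x} → ins x ≤ ∣ S ∩ In x ∣ˢ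
      in≥ {x} = card-⊆ ⟨ (λ y → arcs y x) ⟩ (S ∩ In x) λ { ((y∈S , _) , y→x) → y∈S , y→x }
      shape : ∀ o → 1 + 2 * o ≡ 1 + (o + o)
      shape = solve-∀
      result : ∃[ x ] (x ∈ˢ S × suc (2 * ∣ S ∩ Out x ∣ˢ) ≤ ∣ S ∣ˢ)
      result with balanced
      ... | yes (x , x∈S , o≤i) = x , x∈S , ≤-trans (≤-reflexive (shape ∣ S ∩ Out x ∣ˢ))
        (≤-trans (s≤s (+-monoʳ-≤ ∣ S ∩ Out x ∣ˢ (≤-trans (out≤ x∈S) (≤-trans o≤i in≥)))) (degree-in S x∈S))
      ... | no unbalanced = contradiction (∑-comm λ x y → 𝟙 (arcs y x))
        (<⇒≢ (sum-mono-< ins≤outs s (ins<outs s∈S)))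
        where
        ins<outs : ∀ {x} → x ∈ˢ S → ins x < outs x
        ins<outs x∈S = ≰⇒> λ o≤i → unbalanced (_ , x∈S , o≤i)
        ins≤outs : ∀ x → ins x ≤ outs x
        ins≤outs x = [ <⇒≤ ∘ ins<outs , none ]′ (toSum (mem? S x))
          where
          none : x ∉ˢ S → ins x ≤ outs x
          none x∉S = ≤-trans (card-empty {S = ⟨ (λ y → arcs y x) ⟩} λ { ((_ , x∈S) , _) → x∉S x∈S }) z≤n

-- Insertion into directed paths and systems of disjoint paths

Unique-resp-↭ : ∀ {A : Set} {xs ys : List A} → xs ↭ ys → Unique xs → Unique ys
Unique-resp-↭ {A} xs↭ys = Permutation.Unique-resp-↭ (setoid A) (↭⇒↭ₛ xs↭ys)

Unique-++⁻ : ∀ {A : Set} (xs : List A) {ys} → Unique (xs ++ ys) → Unique xs × Unique ys × Disjoint xs ys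
Unique-++⁻ []       uniq = [] , uniq , λ { (() , _) }
Unique-++⁻ (x ∷ xs) (x∉ ∷ uniq) with Unique-++⁻ xs uniq
... | uxs , uys , xs#ys = All.++⁻ˡ xs x∉ ∷ uxs , uys ,
  λ { (here refl , y∈) → All.lookup (All.++⁻ʳ xs x∉) y∈ refl ; (there x∈ , y∈) → xs#ys (x∈ , y∈) }

module Paths {n : ℕ} (D : Digraph n) (tour : IsTournament D) where
  open Tournament D tour public

  V : Set
  V = Fin n

  -- s is the vertex sequence of a path from x to y, described by how it can be spliced
  -- between two further vertices.
  Segment : V → List V → V → Set
  Segment x s y = ∀ {p q r} → p ⟶ x → y ⟶ q → Linked _⟶_ (q ∷ r) → Linked _⟶_ (p ∷ s ++ q ∷ r)

  single : ∀ {x} → Segment x [ x ] x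
  single p→x y→q l = p→x ∷ y→q ∷ l

  private
    reassoc : ∀ {p v} s xs → Linked _⟶_ (p ∷ s ++ xs ++ [ v ]) → Linked _⟶_ (p ∷ (s ++ xs) ++ [ v ])
    reassoc {p} s xs = subst (λ l → Linked _⟶_ (p ∷ l)) (sym (++-assoc s xs _))

    past : ∀ {q : V} {xs xs′} s → xs′ ↭ s ++ xs → q ∷ xs′ ↭ s ++ q ∷ xs
    past {q} {xs} s perm = ↭-trans (prep q perm) (↭-sym (shift q s xs))

  -- The invariant of the walk along the path is `p ⟶ x`. At the next vertex `q` the whole segment
  -- fits if `y ⟶ q`, and `x` alone fits if `x ⟶ q`; otherwise `q ⟶ x`, and the invariant moves on
  -- to `q`. The walk stops at the latest at the first vertex dominated by `y`.
  insert-forward : ∀ {p x y v s} xs → Segment x s y → x ∉ xs → p ⟶ x → Linked _⟶_ (p ∷ xs ++ [ v ]) →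
    Any (y ⟶_) (xs ++ [ v ]) →
    ∃[ xs′ ] ∃[ s′ ] ((s′ ≡ s ⊎ s′ ≡ [ x ]) × Linked _⟶_ (p ∷ xs′ ++ [ v ]) × xs′ ↭ s′ ++ xs)
  insert-forward {s = s} [] seg x∉ p→x l (here y→v) =
    s , s , inj₁ refl , seg p→x y→v [-] , ↭-reflexive (sym (++-identityʳ s))
  insert-forward {x = x} {y} {s = s} (q ∷ qs) seg x∉ p→x (p→q ∷ l) y→ with y ⟶? q
  ... | yes y→q = s ++ q ∷ qs , s , inj₁ refl , reassoc s (q ∷ qs) (seg p→x y→q l) , ↭-refl
  ... | no ¬y→q with x ⟶? q
  ...   | yes x→q = x ∷ q ∷ qs , [ x ] , inj₂ refl , p→x ∷ x→q ∷ l , ↭-refl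
  ...   | no ¬x→q with insert-forward qs seg (x∉ ∘ there) (connex (x∉ ∘ here) ¬x→q) l (Any.tail ¬y→q y→)
  ...     | xs′ , s′ , which , l′ , perm = q ∷ xs′ , s′ , which , p→q ∷ l′ , past s′ perm

  -- If `y` does not dominate the next vertex, that vertex dominates `y`. From then on only `y` is
  -- carried along, and `y ⟶ v` guarantees it a place.
  insert-here : ∀ {p x y v s} xs → Segment x s y → y ∉ xs → p ⟶ x → y ⟶ v → Linked _⟶_ (p ∷ xs ++ [ v ]) →
    ∃[ xs′ ] ∃[ s′ ] ((s′ ≡ s ⊎ s′ ≡ [ y ]) × Linked _⟶_ (p ∷ xs′ ++ [ v ]) × xs′ ↭ s′ ++ xs)
  insert-here {s = s} [] seg y∉ p→x y→v l =
    s , s , inj₁ refl , seg p→x y→v [-] , ↭-reflexive (sym (++-identityʳ s))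
  insert-here {y = y} {s = s} (q ∷ qs) seg y∉ p→x y→v (p→q ∷ l) with y ⟶? q
  ... | yes y→q = s ++ q ∷ qs , s , inj₁ refl , reassoc s (q ∷ qs) (seg p→x y→q l) , ↭-refl
  ... | no ¬y→q with insert-here qs single (y∉ ∘ there) (connex (y∉ ∘ here) ¬y→q) y→v l
  ...   | xs′ , s′ , which , l′ , perm = q ∷ xs′ , s′ , inj₂ ([ id , id ]′ which) , p→q ∷ l′ , past s′ perm

  -- Dual of `insert-forward`: the exit `y ⟶ v` is given and the entry to `x` has to be looked for,
  -- so the fallback is `y` alone.
  insert-backward : ∀ {p x y v s} xs → Segment x s y → y ∉ xs → y ⟶ v → Linked _⟶_ (p ∷ xs ++ [ v ]) →
    Any (_⟶ x) (p ∷ xs) →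
    ∃[ xs′ ] ∃[ s′ ] ((s′ ≡ s ⊎ s′ ≡ [ y ]) × Linked _⟶_ (p ∷ xs′ ++ [ v ]) × xs′ ↭ s′ ++ xs)
  insert-backward xs seg y∉ y→v l (here p→x) = insert-here xs seg y∉ p→x y→v l
  insert-backward (q ∷ qs) seg y∉ y→v (p→q ∷ l) (there →x) with insert-backward qs seg (y∉ ∘ there) y→v l →x
  ... | xs′ , s′ , which , l′ , perm = q ∷ xs′ , s′ , which , p→q ∷ l′ , past s′ perm

  insert-after : ∀ {p x} xs → x ∉ xs → p ⟶ x → Linked _⟶_ (p ∷ xs) →
    ∃[ xs′ ] (Linked _⟶_ (p ∷ xs′) × xs′ ↭ x ∷ xs)
  insert-after {x = x} [] x∉ p→x l = [ x ] , p→x ∷ [-] , ↭-refl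
  insert-after {x = x} (q ∷ qs) x∉ p→x (p→q ∷ l) with x ⟶? q
  ... | yes x→q = x ∷ q ∷ qs , p→x ∷ x→q ∷ l , ↭-refl
  ... | no ¬x→q with insert-after qs (x∉ ∘ there) (connex (x∉ ∘ here) ¬x→q) l
  ...   | xs′ , l′ , perm = q ∷ xs′ , p→q ∷ l′ , past [ x ] perm

  -- Rédei's theorem by induction: a new vertex that does not dominate the first vertex of the path
  -- is dominated by it, and `insert-after` finds its place.
  hamiltonian-path : ∀ {xs} → Unique xs → ∃[ xs′ ] (Linked _⟶_ xs′ × xs′ ↭ xs)
  hamiltonian-path {[]} [] = [] , [] , ↭-refl
  hamiltonian-path {x ∷ xs} (x∉ ∷ uniq) with hamiltonian-path uniq
  ... | [] , l , perm = [ x ] , [-] , prep x perm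
  ... | q ∷ qs , l , perm with x ⟶? q
  ...   | yes x→q = x ∷ q ∷ qs , x→q ∷ l , prep x perm
  ...   | no ¬x→q with x∉′ ← (λ x∈ → All.lookup x∉ (∈-resp-↭ perm x∈) refl)
                  with insert-after qs (x∉′ ∘ there) (connex (x∉′ ∘ here) ¬x→q) l
  ...     | xs′ , l′ , perm′ = q ∷ xs′ , l′ , ↭-trans (past [ x ] perm′) (prep x perm)

  -- Only interiors are listed. Their being nonempty rules out the bare arc `u ⟶ v`, so disjointness
  -- makes the paths pairwise distinct. The one condition `unique` says at once that the paths are
  -- simple, internally disjoint and meet `u` and `v` only at their ends.
  record System (u v : V) (ss : List (List V)) : Set where
    field
      nonempty : All (_≢ []) ss
      linked   : All (λ xs → Linked _⟶_ (u ∷ xs ++ [ v ])) ss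
      unique   : Unique (u ∷ v ∷ concat ss)

  module _ {u v : V} where

    replace : ∀ {ss xs xs′} s → xs ∈ ss → s ≢ [] → Linked _⟶_ (u ∷ xs′ ++ [ v ]) → xs′ ↭ s ++ xs →
      All (_≢ []) ss → All (λ xs → Linked _⟶_ (u ∷ xs ++ [ v ])) ss →
      ∃[ ss′ ] (All (_≢ []) ss′ × All (λ xs → Linked _⟶_ (u ∷ xs ++ [ v ])) ss′ ×
                length ss′ ≡ length ss × concat ss′ ↭ s ++ concat ss)
    replace {xs ∷ ss} {xs′ = xs′} s (here refl) s≢[] l perm (_ ∷ ne) (_ ∷ ls) =
      xs′ ∷ ss , (λ { refl → s≢[] (nil s perm) }) ∷ ne , l ∷ ls , refl ,
      ↭-trans (++⁺ʳ (concat ss) perm) (↭-reflexive (++-assoc s xs (concat ss)))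
      where
      nil : ∀ s → [] ↭ s ++ xs → s ≡ []
      nil []      _ = refl
      nil (_ ∷ _) p with () ← ↭-length p
    replace {ys ∷ ss} s (there xs∈) s≢[] l perm (y ∷ ne) (l₀ ∷ ls) with replace s xs∈ s≢[] l perm ne ls
    ... | ss′ , ne′ , ls′ , len , perm′ =
      ys ∷ ss′ , y ∷ ne′ , l₀ ∷ ls′ , cong suc len , ↭-trans (++⁺ˡ ys perm′) (shifts ys s)

    Extension : List (List V) → Set
    Extension ss = ∃[ ss′ ] (System u v ss′ × length ss′ ≡ length ss ×
      ∃[ s ] (s ≢ [] × concat ss′ ↭ s ++ concat ss))

    extend : ∀ {ss xs xs′ s} → System u v ss → xs ∈ ss → s ≢ [] → Linked _⟶_ (u ∷ xs′ ++ [ v ]) →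
        xs′ ↭ s ++ xs →
      Unique s → (∀ {x} → x ∈ s → x ∉ u ∷ v ∷ concat ss) → Extension ss
    extend {ss} {s = s} sys xs∈ s≢[] l perm uniq fresh with replace s xs∈ s≢[] l perm (System.nonempty sys)
        (System.linked sys)
    ... | ss′ , ne′ , ls′ , len , perm′ = ss′ , record { nonempty = ne′ ; linked = ls′ ; unique = unique′ } ,
      len , s , s≢[] , perm′
      where
      unique′ : Unique (u ∷ v ∷ concat ss′)
      unique′ = Unique-resp-↭ (↭-trans (shifts s (u ∷ v ∷ [])) (prep u (prep v (↭-sym perm′))))
        (Unique.++⁺ uniq (System.unique sys) λ { (x∈s , x∈ss) → fresh x∈s x∈ss })

    last-snoc : ∀ (xs : List V) → last (xs ++ [ v ]) ≡ just v
    last-snoc []           = refl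
    last-snoc (_ ∷ [])     = refl
    last-snoc (_ ∷ y ∷ xs) = last-snoc (y ∷ xs)

    system-container : ∀ {ss} → System u v ss → 1 ≤ length ss → (∀ x → x ∈ u ∷ v ∷ concat ss) →
      Container D (length ss) u v
    system-container {ss} sys 1≤ covers = record
      { path     = path
      ; isPath   = λ i → record
        { starts = refl ; ends = last-snoc (u ∷ lookup ss i)
        ; arcs = All.lookup linked (∈-lookup i) ; distinct = path-unique i }
      ; distinct = path-distinct
      ; disjoint = path-disjoint
      ; spanning = spanning
      }
      where
      open System sys
      path : Fin (length ss) → List V
      path i = u ∷ lookup ss i ++ [ v ]
      inner : Unique (concat ss)
      inner with _ ∷ _ ∷ uniq ← unique = uniq
      ends-fresh : u ≢ v × (∀ {x} → x ∈ concat ss → u ≢ x × v ≢ x)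
      ends-fresh with (u≢v ∷ u∉) ∷ v∉ ∷ _ ← unique = u≢v , λ x∈ → All.lookup u∉ x∈ , All.lookup v∉ x∈
      in-concat : ∀ ss i {x} → x ∈ lookup ss i → x ∈ concat ss
      in-concat ss i x∈ = ∈-concat⁺′ {xss = ss} x∈ (∈-lookup {xs = ss} i)
      part-unique : ∀ {xs} ss → xs ∈ ss → Unique (concat ss) → Unique xs
      part-unique (ys ∷ ss) (here refl) uniq = proj₁ (Unique-++⁻ ys uniq)
      part-unique (ys ∷ ss) (there xs∈) uniq = part-unique ss xs∈ (proj₁ (proj₂ (Unique-++⁻ ys uniq)))
      parts-disjoint : ∀ ss {i j x} → Unique (concat ss) → i ≢ j → x ∈ lookup ss i → x ∉ lookup ss j
      parts-disjoint (ys ∷ ss) {zero} {zero} uniq i≢j x∈ x∈′ = i≢j refl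
      parts-disjoint (ys ∷ ss) {zero} {suc j} uniq i≢j x∈ x∈′ =
        proj₂ (proj₂ (Unique-++⁻ ys uniq)) (x∈ , in-concat ss j x∈′)
      parts-disjoint (ys ∷ ss) {suc i} {zero} uniq i≢j x∈ x∈′ =
        proj₂ (proj₂ (Unique-++⁻ ys uniq)) (x∈′ , in-concat ss i x∈)
      parts-disjoint (ys ∷ ss) {suc i} {suc j} uniq i≢j x∈ x∈′ =
        parts-disjoint ss (proj₁ (proj₂ (Unique-++⁻ ys uniq))) (i≢j ∘ cong suc) x∈ x∈′
      path-unique : ∀ i → Unique (path i)
      path-unique i = All.tabulate (λ x∈ → u-fresh (∈-++⁻ (lookup ss i) x∈)) ∷
        Unique.++⁺ (part-unique ss (∈-lookup i) inner) ([] ∷ [])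
          λ { (x∈ , here refl) → proj₂ (proj₂ ends-fresh (in-concat ss i x∈)) refl }
        where
        u-fresh : ∀ {x} → x ∈ lookup ss i ⊎ x ∈ [ v ] → u ≢ x
        u-fresh (inj₁ x∈)          = proj₁ (proj₂ ends-fresh (in-concat ss i x∈))
        u-fresh (inj₂ (here refl)) = proj₁ ends-fresh
      path-distinct : ∀ {i j} → i ≢ j → path i ≢ path j
      path-distinct {i} {j} i≢j eq = All.lookup nonempty (∈-lookup i)
        (no-common (lookup ss i) (++-cancelʳ [ v ] (lookup ss i) (lookup ss j) (∷-injectiveʳ eq))
            (parts-disjoint ss inner i≢j))
        where
        no-common : ∀ xs {ys} → xs ≡ ys → (∀ {x} → x ∈ xs → x ∉ ys) → xs ≡ []
        no-common []      _    _    = refl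
        no-common (_ ∷ _) refl disj = ⊥-elim (disj (here refl) (here refl))
      classify : ∀ i {x} → x ∈ path i → (x ≡ u ⊎ x ≡ v) ⊎ x ∈ lookup ss i
      classify i (here x≡u) = inj₁ (inj₁ x≡u)
      classify i (there x∈) with ∈-++⁻ (lookup ss i) x∈
      ... | inj₁ x∈ᵢ       = inj₂ x∈ᵢ
      ... | inj₂ (here x≡v) = inj₁ (inj₂ x≡v)
      path-disjoint : ∀ {i j} → i ≢ j → ∀ {x} → x ∈ path i → x ∈ path j → x ≡ u ⊎ x ≡ v
      path-disjoint {i} {j} i≢j x∈ x∈′ with classify i x∈ | classify j x∈′
      ... | inj₁ end | _        = end
      ... | _        | inj₁ end = end
      ... | inj₂ x∈ᵢ | inj₂ x∈ⱼ = contradiction x∈ⱼ (parts-disjoint ss inner i≢j x∈ᵢ)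
      first : Fin (length ss)
      first = fromℕ< 1≤
      spanning : ∀ x → ∃[ i ] x ∈ path i
      spanning x with covers x
      ... | here x≡u         = first , here x≡u
      ... | there (here x≡v) = first , there (∈-++⁺ʳ (lookup ss first) (here x≡v))
      ... | there (there x∈) with ∈-concat⁻′ ss x∈
      ...   | xs , x∈xs , xs∈ = index xs∈ , there (∈-++⁺ˡ (subst (x ∈_) (lookup-index xs∈) x∈xs))

-- Detours of at most three steps in near-regular tournaments

module NearRegular {n : ℕ} (D : Digraph n) (tour : IsTournament D) (k : ℕ)
  (out≥ : ∀ x → n ≤ 1 + k + 2 * ∣ Neighbours.Out D x ∣ˢ)
      (in≥ : ∀ x → n ≤ 1 + k + 2 * ∣ Neighbours.In D x ∣ˢ) where
  open Paths D tour public

  degree-sum : ∀ x → 1 + (∣ Out x ∣ˢ + ∣ In x ∣ˢ) ≤ n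
  degree-sum x = ≤-trans
    (s≤s (+-mono-≤ (card-⊆ (Out x) (full ∩ Out x) λ x→y → _ , x→y)
        (card-⊆ (In x) (full ∩ In x) λ y→x → _ , y→x)))
    (≤-trans (degree-in full _) (≤-reflexive card-full))

  out≤ : ∀ x → 1 + 2 * ∣ Out x ∣ˢ ≤ n + k
  out≤ x = linear (1 + 2 * o) (n + k) 0 (+-mono-≤ (*-monoʳ-≤ 2 (degree-sum x)) (in≥ x)) (eq n k o i)
    where
    o = ∣ Out x ∣ˢ
    i = ∣ In x ∣ˢ
    eq : ∀ n k o i → 2 * (1 + (o + i)) + n + (n + k) ≡ 2 * n + (1 + k + 2 * i) + (1 + 2 * o) + 0
    eq = solve-∀

  -- Route x y s: a path from x to y of length at most two whose vertices after x are s.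
  data Route (x : V) : V → List V → Set where
    at    : Route x x []
    step  : ∀ {y} → x ⟶ y → Route x y [ y ]
    step² : ∀ {m y} → x ⟶ m → m ⟶ y → Route x y (m ∷ y ∷ [])

  -- In the applications `W` consists of the system and one of the two ends, while `u` is the end to
  -- be avoided. If no admissible vertex within two steps of `x` dominates a vertex of `W`, then
  -- `v ∈ W` dominates all out-neighbours of `x` other than `u` and nearly all of theirs, which is
  -- too much for its outdegree.
  reach : ∀ (W : VSet n) {u v} → v ∈ˢ W → 6 + 5 * k ≤ n → ∀ x → x ∉ˢ W → x ≢ u →
    ∃[ y ] ∃[ s ] (Route x y s × (∀ {z} → z ∈ x ∷ s → z ∉ˢ W × z ≢ u) × ∃[ w ] (y ⟶ w × w ∈ˢ W))
  reach W {u} {v} v∈W large x x∉W x≢u = search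
    where
    Hits : VSet n
    Hits = ⟨ (λ y → any? λ w → (y ⟶? w) ×-dec mem? W w) ⟩
    Result : Set
    Result = ∃[ y ] ∃[ s ] (Route x y s × (∀ {z} → z ∈ x ∷ s → z ∉ˢ W × z ≢ u) × y ∈ˢ Hits)
    search : Result
    search with mem? Hits x
    ... | yes hit = x , [] , at , (λ { (here refl) → x∉W , x≢u }) , hit
    ... | no ¬hit with any? (λ y → (x ⟶? y) ×-dec ¬? (y ≟ᶠ u) ×-dec mem? Hits y)
    ...   | yes (y , x→y , y≢u , hit) = y , [ y ] , step x→y ,
      (λ { (here refl) → x∉W , x≢u ; (there (here refl)) → (λ y∈W → ¬hit (y , x→y , y∈W)) , y≢u }) , hit
    ...   | no ¬hit₁ with any? (λ m → ((x ⟶? m) ×-dec ¬? (m ≟ᶠ u)) ×-dec any? λ y → (m ⟶? y) ×-dec ¬?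
        (y ≟ᶠ u) ×-dec mem? Hits y)
    ...     | yes (m , (x→m , m≢u) , y , m→y , y≢u , hit) = y , m ∷ y ∷ [] , step² x→m m→y ,
      (λ { (here refl) → x∉W , x≢u ; (there (here refl)) → (λ m∈W → ¬hit (m , x→m , m∈W)) , m≢u
         ; (there (there (here refl))) → (λ y∈W → ¬hit₁ (m , x→m , m≢u , y , m→y , y∈W)) , y≢u }) , hit
    ...     | no ¬hit₂ = ⊥-elim (impossible (small-outdegree Y (proj₂ some)))
      where
      Y U O : VSet n
      Y = Out x ∩ ∁ ⟦ [ u ] ⟧
      U = ⟦ [ u ] ⟧
      O = Out v ∩ ∁ Y
      outs-x : ∣ Out x ∣ˢ ≤ ∣ Y ∣ˢ + 1
      outs-x = ≤-trans (card-cover (Out x) Y U split) (+-monoʳ-≤ _ (card-list [ u ]))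
        where
        split : ∀ {y} → x ⟶ y → y ∈ˢ Y ⊎ y ∈ˢ U
        split {y} x→y with mem? U y
        ... | yes y∈U = inj₂ y∈U
        ... | no y∉U  = inj₁ (x→y , y∉U)
      n≤Y : n ≤ 1 + k + 2 * (∣ Y ∣ˢ + 1)
      n≤Y = ≤-trans (out≥ x) (+-monoʳ-≤ (1 + k) (*-monoʳ-≤ 2 outs-x))
      some : ∃[ y ] y ∈ˢ Y
      some = card-nonempty Y (≰⇒> λ Y≤0 → contradiction
        (linear 1 0 (2 + 4 * k) (+-mono-≤ (+-mono-≤ n≤Y large) (*-monoʳ-≤ 2 Y≤0)) (eq n k ∣ Y ∣ˢ)) λ ())
        where
        eq : ∀ n k Y → n + (6 + 5 * k) + 2 * Y + 0 ≡ (1 + k + 2 * (Y + 1)) + n + 2 * 0 + 1 + (2 + 4 * k)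
        eq = solve-∀
      beyond : ∀ {y} → y ≢ v → ¬ y ∈ˢ Hits → v ⟶ y
      beyond y≢v ¬hit = connex y≢v λ y→v → ¬hit (v , y→v , v∈W)
      v→Y : ∀ {y} → y ∈ˢ Y → v ⟶ y
      v→Y {y} (x→y , y∉U) = beyond (λ { refl → ¬hit (v , x→y , v∈W) }) λ h → ¬hit₁ (y , x→y , y∉U ∘ here , h)
      inside : ∣ Y ∣ˢ + ∣ O ∣ˢ ≤ ∣ Out v ∣ˢ
      inside = card-disjoint Y O (Out v) v→Y proj₁ λ y∈Y y∈O → proj₂ y∈O y∈Y
      -- Here `∣ Y ∣ ≥ (n - k - 3) / 2`. The out-neighbours of `y` are at most `(∣ Y ∣ - 1) / 2`
      -- vertices of `Y`, possibly `u`, and vertices of `O`, where `∣ O ∣` is at most the outdegree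
      -- of `v` minus `∣ Y ∣`. The degree bounds at `y` and `v` then leave only `n ≤ 5 + 5 k`.
      impossible : ∃[ y ] (y ∈ˢ Y × suc (2 * ∣ Y ∩ Out y ∣ˢ) ≤ ∣ Y ∣ˢ) → ⊥
      impossible (y , y∈Y@(x→y , y∉U) , few) = contradiction
        (linear 1 0 0 (+-mono-≤ (+-mono-≤ (+-mono-≤ n≤Y large) (*-monoʳ-≤ 2 few))
          (+-mono-≤ (+-mono-≤ (*-monoʳ-≤ 2 n≤y) (*-monoʳ-≤ 4 inside)) (*-monoʳ-≤ 2 (out≤ v))))
          (eq n k ∣ Y ∣ˢ ∣ Y ∩ Out y ∣ˢ ∣ O ∣ˢ ∣ Out v ∣ˢ)) λ ()
        where
        split : ∀ {z} → y ⟶ z → z ∈ˢ U ⊎ z ∈ˢ (Y ∩ Out y) ∪ O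
        split {z} y→z with mem? U z | mem? Y z
        ... | yes z∈U | _       = inj₁ z∈U
        ... | no _    | yes z∈Y = inj₂ (inj₁ (z∈Y , y→z))
        ... | no z∉U  | no z∉Y  = inj₂ (inj₂ (beyond (λ { refl → asym y→z (v→Y y∈Y) })
          (λ h → ¬hit₂ (y , (x→y , y∉U ∘ here) , z , y→z , z∉U ∘ here , h)) , z∉Y))
        outs-y : ∣ Out y ∣ˢ ≤ 1 + (∣ Y ∩ Out y ∣ˢ + ∣ O ∣ˢ)
        outs-y = ≤-trans (card-cover (Out y) U ((Y ∩ Out y) ∪ O) split)
          (+-mono-≤ (card-list [ u ]) (card-cover ((Y ∩ Out y) ∪ O) (Y ∩ Out y) O id))
        n≤y : n ≤ 1 + k + 2 * (1 + (∣ Y ∩ Out y ∣ˢ + ∣ O ∣ˢ))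
        n≤y = ≤-trans (out≥ y) (+-monoʳ-≤ (1 + k) (*-monoʳ-≤ 2 outs-y))
        eq : ∀ n k Y o O v → n + (6 + 5 * k) + 2 * (1 + 2 * o) + (2 * n + 4 * (Y + O) + 2 * (1 + 2 * v)) + 0
          ≡ (1 + k + 2 * (Y + 1)) + n + 2 * Y + (2 * (1 + k + 2 * (1 + (o + O))) + 4 * v + 2 * (n + k)) + 1 + 0
        eq = solve-∀

-- Absorbing vertices into a path system

module Large {n : ℕ} (D : Digraph n) (tour : IsTournament D) (k : ℕ)
  (out≥ : ∀ x → n ≤ 1 + k + 2 * ∣ Neighbours.Out D x ∣ˢ) (in≥ : ∀ x → n ≤ 1 + k + 2 * ∣ Neighbours.In D x ∣ˢ)
  (t : ℕ) (t≥2 : 2 ≤ t) (n≥ : 6 * t + 5 * k ≤ n) where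
  open NearRegular D tour k out≥ in≥ public

  large : 6 + 5 * k ≤ n
  large = ≤-trans (+-monoˡ-≤ (5 * k) (≤-trans (m≤m+n 6 6) (*-monoʳ-≤ 6 t≥2))) n≥

  module Reverse = NearRegular (reverse-digraph D) (reverse-tournament D tour) k in≥ out≥

  module _ {u v : V} {ss : List (List V)} (sys : System u v ss) (ω≥1 : 1 ≤ length ss) where
    open System sys

    host : ∀ {w} → w ∈ concat ss → ∃[ xs ] (xs ∈ ss × w ∈ xs)
    host w∈ with ∈-concat⁻′ ss w∈
    ... | xs , w∈xs , xs∈ = xs , xs∈ , w∈xs

    some-path : ∃[ xs ] xs ∈ ss
    some-path = lookup ss (fromℕ< ω≥1) , ∈-lookup {xs = ss} (fromℕ< ω≥1)

    -- The arc `u ⟶ x` is the entry and the last arc of the detour is the exit that `insert-forward`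
    -- asks for. A detour that hits `v` may go into any path, since `v` ends all of them.
    absorb-out : ∀ {x} → x ∉ u ∷ v ∷ concat ss → u ⟶ x → Extension {u} {v} ss
    absorb-out {x} x∉ u→x with reach ⟦ v ∷ concat ss ⟧ (here refl) large x (x∉ ∘ there) (x∉ ∘ here)
    ... | y , s , route , fresh , w , y→w , w∈ = insert target
      where
      target : ∃[ xs ] (xs ∈ ss × Any (y ⟶_) (xs ++ [ v ]))
      target = locate w∈
        where
        locate : w ∈ v ∷ concat ss → ∃[ xs ] (xs ∈ ss × Any (y ⟶_) (xs ++ [ v ]))
        locate (here refl) with some-path
        ... | xs , xs∈ = xs , xs∈ , lose {P = y ⟶_} (∈-++⁺ʳ xs (here refl)) y→w
        locate (there w∈) with host w∈
        ... | xs , xs∈ , w∈xs = xs , xs∈ , lose {P = y ⟶_} (∈-++⁺ˡ w∈xs) y→w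
      segment : ∀ {s} → Route x y s → Segment x (x ∷ s) y
      segment at              p→x y→q l = p→x ∷ y→q ∷ l
      segment (step x→y)      p→x y→q l = p→x ∷ x→y ∷ y→q ∷ l
      segment (step² x→m m→y) p→x y→q l = p→x ∷ x→m ∷ m→y ∷ y→q ∷ l
      distinct : ∀ {s} → Route x y s → Unique (x ∷ s)
      distinct at              = [] ∷ []
      distinct (step x→y)      = (arc-≢ x→y ∷ []) ∷ [] ∷ []
      distinct (step² x→m m→y) = (arc-≢ x→m ∷ (λ { refl → asym x→m m→y }) ∷ []) ∷ (arc-≢ m→y ∷ []) ∷ [] ∷ []
      fresh′ : ∀ {z} → z ∈ x ∷ s → z ∉ u ∷ v ∷ concat ss
      fresh′ z∈ (here z≡u)  = proj₂ (fresh z∈) z≡u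
      fresh′ z∈ (there z∈′) = proj₁ (fresh z∈) z∈′
      insert : ∃[ xs ] (xs ∈ ss × Any (y ⟶_) (xs ++ [ v ])) → Extension {u} {v} ss
      insert (xs , xs∈ , →w) with insert-forward xs (segment route)
          (λ x∈ → x∉ (there (there (∈-concat⁺′ x∈ xs∈)))) u→x (All.lookup linked xs∈) →w
      ... | xs′ , _ , inj₁ refl , l , perm = extend sys xs∈ (λ ()) l perm (distinct route) fresh′
      ... | xs′ , _ , inj₂ refl , l , perm = extend sys xs∈ (λ ()) l perm ([] ∷ []) λ { (here refl) → x∉ }

    -- The detour is found in the reversed tournament, with `u` among the targets and `v` avoided,
    -- and is then traversed backwards.
    absorb-in : ∀ {x} → x ∉ u ∷ v ∷ concat ss → x ⟶ v → Extension {u} {v} ss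
    absorb-in {x} x∉ x→v with Reverse.reach ⟦ u ∷ concat ss ⟧ (here refl) large x
        (λ { (here x≡u) → x∉ (here x≡u) ; (there x∈) → x∉ (there (there x∈)) }) (x∉ ∘ there ∘ here)
    ... | y , s , route , fresh , w , w→y , w∈ = insert target
      where
      target : ∃[ xs ] (xs ∈ ss × Any (_⟶ y) (u ∷ xs))
      target = locate w∈
        where
        locate : w ∈ u ∷ concat ss → ∃[ xs ] (xs ∈ ss × Any (_⟶ y) (u ∷ xs))
        locate (here refl) with some-path
        ... | xs , xs∈ = xs , xs∈ , here w→y
        locate (there w∈) with host w∈
        ... | xs , xs∈ , w∈xs = xs , xs∈ , there (lose w∈xs w→y)
      backwards : ∀ {s} → Reverse.Route x y s → ∃[ s′ ]
          (Segment y s′ x × s′ ≢ [] × Unique s′ × (∀ {z} → z ∈ s′ → z ∈ x ∷ s))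
      backwards Reverse.at = [ x ] , single , (λ ()) , [] ∷ [] , λ { (here refl) → here refl }
      backwards (Reverse.step y→x) = y ∷ x ∷ [] , (λ p→y x→q l → p→y ∷ y→x ∷ x→q ∷ l) , (λ ()) ,
        (arc-≢ y→x ∷ []) ∷ [] ∷ [] , λ { (here refl) → there (here refl) ; (there (here refl)) → here refl }
      backwards (Reverse.step² m→x y→m) = y ∷ _ ∷ x ∷ [] , (λ p→y x→q l → p→y ∷ y→m ∷ m→x ∷ x→q ∷ l) , (λ ()) ,
        (arc-≢ y→m ∷ (λ { refl → asym m→x y→m }) ∷ []) ∷ (arc-≢ m→x ∷ []) ∷ [] ∷ [] ,
        λ { (here refl) → there (there (here refl)) ; (there (here refl)) → there (here refl) ;
            (there (there (here refl))) → here refl }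
      fresh′ : ∀ {z} → z ∈ x ∷ s → z ∉ u ∷ v ∷ concat ss
      fresh′ z∈ (here z≡u)          = proj₁ (fresh z∈) (here z≡u)
      fresh′ z∈ (there (here z≡v))  = proj₂ (fresh z∈) z≡v
      fresh′ z∈ (there (there z∈′)) = proj₁ (fresh z∈) (there z∈′)
      insert : ∃[ xs ] (xs ∈ ss × Any (_⟶ y) (u ∷ xs)) → Extension {u} {v} ss
      insert (xs , xs∈ , w→) with backwards route
      ... | s′ , seg , s′≢[] , uniq , s′⊆ with insert-backward xs seg
          (λ x∈ → x∉ (there (there (∈-concat⁺′ x∈ xs∈)))) x→v (All.lookup linked xs∈) w→
      ...   | xs′ , _ , inj₁ refl , l , perm = extend sys xs∈ s′≢[] l perm uniq (fresh′ ∘ s′⊆)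
      ...   | xs′ , _ , inj₂ refl , l , perm = extend sys xs∈ (λ ()) l perm ([] ∷ []) λ { (here refl) → x∉ }

  -- A missing vertex lies in N⁺u, in N⁻v or in `C`, and the hypothesis excludes the last.
  -- Absorption never changes the number of paths.
  complete : ∀ {u v ss} → System u v ss → 1 ≤ length ss → (∀ {x} → v ⟶ x → x ⟶ u → x ∈ concat ss) →
    Container D (length ss) u v
  complete {u} {v} {ss} sys = loop n ss sys (m≤n+m n _)
    where
    -- `m` bounds the number of absorptions still to come: each one adds at least one interior
    -- vertex, and `m` cannot be zero because `u` and `v` are never interior.
    loop : ∀ m ss → System u v ss → n ≤ length (concat ss) + m → 1 ≤ length ss →
      (∀ {x} → v ⟶ x → x ⟶ u → x ∈ concat ss) → Container D (length ss) u v
    loop m ss sys bound ω≥1 C⊆ with any? (λ x → ¬? (x ∈? (u ∷ v ∷ concat ss)))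
    ... | no all-covered = system-container sys ω≥1 λ x → decidable-stable (x ∈? _) λ x∉ → all-covered (x , x∉)
    ... | yes (x , x∉) = continue m bound (absorb (total (x∉ ∘ here ∘ sym)) (total (x∉ ∘ there ∘ here)))
      where
      absorb : u ⟶ x ⊎ x ⟶ u → x ⟶ v ⊎ v ⟶ x → Extension {u} {v} ss
      absorb (inj₁ u→x) _          = absorb-out sys ω≥1 x∉ u→x
      absorb (inj₂ _)   (inj₁ x→v) = absorb-in sys ω≥1 x∉ x→v
      absorb (inj₂ x→u) (inj₂ v→x) = ⊥-elim (x∉ (there (there (C⊆ v→x x→u))))
      continue : ∀ m → n ≤ length (concat ss) + m → Extension {u} {v} ss → Container D (length ss) u v
      continue _ _ (_ , _ , _ , [] , s≢[] , _) = ⊥-elim (s≢[] refl)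
      continue zero bound (ss′ , sys′ , len , y ∷ s , _ , perm) = contradiction
          (≤-trans (length-unique (System.unique sys)) bound)
          (<⇒≱ (s≤s (≤-trans (≤-reflexive (+-identityʳ _)) (n≤1+n _))))
      continue (suc m) bound (ss′ , sys′ , len , y ∷ s , _ , perm) = subst (λ ω → Container D ω u v) len
        (loop m ss′ sys′ bound′ (subst (1 ≤_) (sym len) ω≥1) λ v→x x→u → ∈-resp-↭ (↭-sym perm)
            (there (∈-++⁺ʳ s (C⊆ v→x x→u))))
        where
        bound′ : n ≤ length (concat ss′) + m
        bound′ = ≤-trans bound (≤-trans (≤-reflexive (+-suc _ m))
            (+-monoˡ-≤ m (≤-trans (s≤s (length-++-≤ʳ (concat ss) {s})) (≤-reflexive (sym (↭-length perm))))))

  in≤ : ∀ x → 1 + 2 * ∣ In x ∣ˢ ≤ n + k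
  in≤ = Reverse.out≤

  small-indegree : ∀ S {s} → s ∈ˢ S → ∃[ x ] (x ∈ˢ S × suc (2 * ∣ S ∩ In x ∣ˢ) ≤ ∣ S ∣ˢ)
  small-indegree = Reverse.small-outdegree

  -- Some `a ∈ X` has at most `(∣ X ∣ - 1) / 2` out-neighbours in `X`, and all its others lie in
  -- `F`, so `n ≤ k + ∣ X ∣ + 2 ∣ F ∣`. The same holds for `Y` with in-neighbours, and the two
  -- inequalities are added.
  cut-bound : ∀ X Y F {x y} → x ∈ˢ X → y ∈ˢ Y →
    (∀ {a b} → a ∈ˢ X → a ⟶ b → b ∈ˢ X ⊎ b ∈ˢ F) → (∀ {a b} → b ∈ˢ Y → a ⟶ b → a ∈ˢ Y ⊎ a ∈ˢ F) →
    2 * n ≤ 2 * k + (∣ X ∣ˢ + ∣ Y ∣ˢ + 4 * ∣ F ∣ˢ)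
  cut-bound X Y F x∈X y∈Y X-closed Y-closed with small-outdegree X x∈X | small-indegree Y y∈Y
  ... | a , a∈X , few-out | b , b∈Y , few-in = linear (2 * n) _ 0
    (+-mono-≤ (+-mono-≤ (≤-trans (out≥ a) (+-monoʳ-≤ (1 + k) (*-monoʳ-≤ 2 outs)))
        (≤-trans (in≥ b) (+-monoʳ-≤ (1 + k) (*-monoʳ-≤ 2 ins))))
      (+-mono-≤ few-out few-in)) (eq n k ∣ X ∣ˢ ∣ Y ∣ˢ ∣ F ∣ˢ ∣ X ∩ Out a ∣ˢ ∣ Y ∩ In b ∣ˢ)
    where
    outs : ∣ Out a ∣ˢ ≤ ∣ X ∩ Out a ∣ˢ + ∣ F ∣ˢ
    outs = card-cover (Out a) (X ∩ Out a) F λ a→b → [ (λ b∈X → inj₁ (b∈X , a→b)) , inj₂ ]′ (X-closed a∈X a→b)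
    ins : ∣ In b ∣ˢ ≤ ∣ Y ∩ In b ∣ˢ + ∣ F ∣ˢ
    ins = card-cover (In b) (Y ∩ In b) F λ a→b → [ (λ a∈Y → inj₁ (a∈Y , a→b)) , inj₂ ]′ (Y-closed b∈Y a→b)
    eq : ∀ n k X Y F o i → n + n + (1 + 2 * o + (1 + 2 * i)) + (2 * k + (X + Y + 4 * F))
      ≡ 1 + k + 2 * (o + F) + (1 + k + 2 * (i + F)) + (X + Y) + 2 * n + 0
    eq = solve-∀

  -- Short routes from `u` to a vertex of `C`

  module _ (u v : V) {c : V} (v→c : v ⟶ c) (c→u : c ⟶ u) (X Y : VSet n) where

    -- `X` is forbidden for the vertex entering `c`, `Y` for the first vertex of a longer route.
    -- They are kept apart because the count charges them differently, `2 x` against `4 y`.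
    Direct Via : Set
    Direct = ∃[ a ] (u ⟶ a × a ≢ v × a ⟶ c × a ∉ˢ X)
    Via    = ∃[ a ] ∃[ d ] ((u ⟶ a × a ∉ˢ Y) × a ⟶ d × d ⟶ c × d ⟶ u × d ⟶ v × d ∉ˢ X)

    -- Without a direct route the in-neighbours of `c` lie in `I`, apart from `v`, other vertices of
    -- N⁺v ∩ N⁻u and `X`. Take a vertex of `I` with few in-neighbours in `I`. Without a longer route
    -- its in-neighbours lie in `Y` or in N⁻u, and the indegree of `u` limits the latter. `C` is a
    -- numerical bound so that the lemma also serves the reversed tournament, where the intersection
    -- is written in the other order.
    connect-in : ∀ C x y → ∣ Out v ∩ In u ∣ˢ ≤ C → ∣ X ∩ In c ∣ˢ ≤ x → ∣ Y ∩ Out u ∣ˢ ≤ y →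
      2 * C + 2 * x + 4 * y ≤ 6 * t + 4 → 2 * C + 2 * x + 2 ≤ 6 * t → Direct ⊎ Via
    connect-in C x y C≤ x≤ y≤ h₁ h₂ with any?
        (λ a → (u ⟶? a) ×-dec ¬? (a ≟ᶠ v) ×-dec (a ⟶? c) ×-dec ¬? (mem? X a))
    ... | yes direct = inj₁ direct
    ... | no ¬direct with any? (λ a → any? λ d → ((u ⟶? a) ×-dec ¬? (mem? Y a)) ×-dec (a ⟶? d) ×-dec
        (d ⟶? c) ×-dec (d ⟶? u) ×-dec (d ⟶? v) ×-dec ¬? (mem? X d))
    ...   | yes via = inj₂ via
    ...   | no ¬via = ⊥-elim (impossible (small-indegree I (proj₂ some)))
      where
      β I B′ C′ : VSet n
      β  = In u ∩ In v
      I  = β ∩ In c ∩ ∁ X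
      B′ = β ∩ ∁ I
      C′ = (Out v ∩ In u) ∩ ∁ ⟦ [ c ] ⟧
      C′-bound′ : 1 + ∣ C′ ∣ˢ ≤ ∣ Out v ∩ In u ∣ˢ
      C′-bound′ = ≤-trans (+-monoˡ-≤ _ (≤-reflexive (sym (card-singleton c))))
        (card-disjoint ⟨ _≟ᶠ c ⟩ C′ (Out v ∩ In u) (λ { refl → v→c , c→u }) proj₁
            λ { refl y∈ → proj₂ y∈ (here refl) })
      C′-bound : 1 + ∣ C′ ∣ˢ ≤ C
      C′-bound = ≤-trans C′-bound′ C≤
      ins-c : ∣ In c ∣ˢ ≤ 1 + (∣ C′ ∣ˢ + (∣ I ∣ˢ + x))
      ins-c = ≤-trans (card-cover (In c) ⟦ [ v ] ⟧ (C′ ∪ I ∪ (X ∩ In c)) split)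
        (+-mono-≤ (card-list [ v ]) (≤-trans (card-cover _ C′ (I ∪ (X ∩ In c)) id) (+-monoʳ-≤ ∣ C′ ∣ˢ
          (≤-trans (card-cover _ I (X ∩ In c) id) (+-monoʳ-≤ ∣ I ∣ˢ x≤)))))
        where
        split : ∀ {y} → y ⟶ c → y ∈ˢ ⟦ [ v ] ⟧ ⊎ y ∈ˢ C′ ∪ I ∪ (X ∩ In c)
        split {y} y→c with y ≟ᶠ v | mem? X y
        ... | yes refl | _       = inj₁ (here refl)
        ... | no _     | yes y∈X = inj₂ (inj₂ (inj₂ (y∈X , y→c)))
        ... | no y≢v   | no y∉X with total {u} {y} (λ { refl → asym y→c c→u }) | total y≢v
        ...   | inj₁ u→y | _        = ⊥-elim (¬direct (y , u→y , y≢v , y→c , y∉X))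
        ...   | inj₂ y→u | inj₁ y→v = inj₂ (inj₂ (inj₁ ((y→u , y→v) , y→c , y∉X)))
        ...   | inj₂ y→u | inj₂ v→y = inj₂ (inj₁ ((v→y , y→u) , λ { (here refl) → noLoop y→c }))
      n≤c : n ≤ 1 + k + 2 * (1 + (∣ C′ ∣ˢ + (∣ I ∣ˢ + x)))
      n≤c = ≤-trans (in≥ c) (+-monoʳ-≤ (1 + k) (*-monoʳ-≤ 2 ins-c))
      some : ∃[ i ] i ∈ˢ I
      some = card-nonempty I (≰⇒> λ I≤0 → ≤-⊥ (4 * k)
        (+-mono-≤ (+-mono-≤ n≤c n≥) (+-mono-≤ (*-monoʳ-≤ 2 I≤0) (+-mono-≤ (*-monoʳ-≤ 2 C′-bound) h₂)))
            (eq n k t ∣ I ∣ˢ ∣ C′ ∣ˢ C x))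
        where
        eq : ∀ n k t I C′ C x → n + (6 * t + 5 * k) + (2 * I + (2 * (1 + C′) + (2 * C + 2 * x + 2)))
          ≡ 1 + k + 2 * (1 + (C′ + (I + x))) + n + (2 * 0 + (2 * C + 6 * t)) + 1 + 4 * k
        eq = solve-∀
      β-split : ∣ I ∣ˢ + ∣ B′ ∣ˢ ≤ ∣ β ∣ˢ
      β-split = card-disjoint I B′ β proj₁ proj₁ λ y∈I y∈B′ → proj₂ y∈B′ y∈I
      u-ins : ∣ β ∣ˢ + ∣ Out v ∩ In u ∣ˢ ≤ ∣ In u ∣ˢ
      u-ins = card-disjoint β (Out v ∩ In u) (In u) proj₁ proj₂ λ { (_ , y→v) (v→y , _) → asym y→v v→y }
      -- The counts at `i` and `u` give `∣ I ∣ ≤ 2 k + 2 y - 3`, the one at `c` gives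
      -- `n ≤ 1 + k + 2 C + 2 x + 2 ∣ I ∣`. Together `n ≤ 5 k - 5 + 2 C + 2 x + 4 y`, which is where
      -- the `4` in `h₁` comes from.
      impossible : ∃[ i ] (i ∈ˢ I × suc (2 * ∣ I ∩ In i ∣ˢ) ≤ ∣ I ∣ˢ) → ⊥
      impossible (i , i∈I@((i→u , i→v) , i→c , i∉X) , few) = ≤-⊥ 0
        (+-mono-≤ (+-mono-≤ (+-mono-≤ n≤c n≥) (+-mono-≤ (*-monoʳ-≤ 2 n≤i) (*-monoʳ-≤ 2 few)))
          (+-mono-≤ (+-mono-≤ (+-mono-≤ (*-monoʳ-≤ 2 C′-bound) (*-monoʳ-≤ 4 C′-bound′))
              (+-mono-≤ (*-monoʳ-≤ 4 β-split) (*-monoʳ-≤ 4 u-ins)))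
            (+-mono-≤ (*-monoʳ-≤ 2 (in≤ u)) h₁)))
        (eq n k t ∣ I ∣ˢ ∣ C′ ∣ˢ C x y ∣ I ∩ In i ∣ˢ ∣ B′ ∣ˢ ∣ β ∣ˢ ∣ Out v ∩ In u ∣ˢ ∣ In u ∣ˢ)
        where
        split : ∀ {z} → z ⟶ i → z ∈ˢ (I ∩ In i) ∪ B′ ⊎ z ∈ˢ C′ ∪ (Y ∩ Out u)
        split {z} z→i with total {u} {z} (λ { refl → asym z→i i→u }) | total {z} {v} (λ { refl → asym z→i i→v })
        ... | inj₁ u→z | _ with mem? Y z
        ...   | yes z∈Y = inj₂ (inj₂ (z∈Y , u→z))
        ...   | no z∉Y  = ⊥-elim (¬via (z , i , (u→z , z∉Y) , z→i , i→c , i→u , i→v , i∉X))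
        split {z} z→i | inj₂ z→u | inj₂ v→z = inj₂ (inj₁ ((v→z , z→u) , λ { (here refl) → asym z→i i→c }))
        split {z} z→i | inj₂ z→u | inj₁ z→v with mem? I z
        ...   | yes z∈I = inj₁ (inj₁ (z∈I , z→i))
        ...   | no z∉I  = inj₁ (inj₂ ((z→u , z→v) , z∉I))
        ins-i : ∣ In i ∣ˢ ≤ ∣ I ∩ In i ∣ˢ + ∣ B′ ∣ˢ + (∣ C′ ∣ˢ + y)
        ins-i = ≤-trans (card-cover (In i) ((I ∩ In i) ∪ B′) (C′ ∪ (Y ∩ Out u)) split)
          (+-mono-≤ (card-cover _ (I ∩ In i) B′ id)
              (≤-trans (card-cover _ C′ (Y ∩ Out u) id) (+-monoʳ-≤ ∣ C′ ∣ˢ y≤)))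
        n≤i : n ≤ 1 + k + 2 * (∣ I ∩ In i ∣ˢ + ∣ B′ ∣ˢ + (∣ C′ ∣ˢ + y))
        n≤i = ≤-trans (in≥ i) (+-monoʳ-≤ (1 + k) (*-monoʳ-≤ 2 ins-i))
        eq : ∀ n k t I C′ C x y i B′ β C″ d →
          n + (6 * t + 5 * k) + (2 * n + 2 * (1 + 2 * i)) +
              ((2 * (1 + C′) + 4 * (1 + C′)) + (4 * (I + B′) + 4 * (β + C″)) +
              (2 * (1 + 2 * d) + (2 * C + 2 * x + 4 * y)))
          ≡ (1 + k + 2 * (1 + (C′ + (I + x)))) + n + (2 * (1 + k + 2 * (i + B′ + (C′ + y))) + 2 * I) +
              ((2 * C + 4 * C″) + (4 * β + 4 * d) + (2 * (n + k) + (6 * t + 4))) + 1 + 0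
        eq = solve-∀

-- When a cycle based at `z` is cut just before its tail `r`, this is the vertex after the cut; the
-- default `z` covers a cut at the closing arc.
head-or : ∀ {A : Set} → List A → A → A
head-or []      z = z
head-or (q ∷ _) _ = q

count : ∀ {n} → VSet n → List (Fin n) → ℕ
count S []       = 0
count S (x ∷ xs) = 𝟙 (mem? S x) + count S xs

count-filter : ∀ {n} (S : VSet n) xs → length (filter (mem? S) xs) ≡ count S xs
count-filter S []       = refl
count-filter S (x ∷ xs) with mem? S x
... | yes _ = cong suc (count-filter S xs)
... | no _  = count-filter S xs

card-≤count : ∀ {n} (S : VSet n) xs → (∀ {x} → x ∈ˢ S → x ∈ xs) → ∣ S ∣ˢ ≤ count S xs
card-≤count S xs S⊆xs = ≤-trans (card-≤list S (filter (mem? S) xs) λ x∈S → ∈-filter⁺ (mem? S) (S⊆xs x∈S) x∈S)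
  (≤-reflexive (count-filter S xs))

-- Enlarging a system that covers `C`

module Between {n : ℕ} (D : Digraph n) (tour : IsTournament D) (k : ℕ)
  (out≥ : ∀ x → n ≤ 1 + k + 2 * ∣ Neighbours.Out D x ∣ˢ) (in≥ : ∀ x → n ≤ 1 + k + 2 * ∣ Neighbours.In D x ∣ˢ)
  (t : ℕ) (t≥2 : 2 ≤ t) (n≥ : 6 * t + 5 * k ≤ n) (u v : Fin n) (u≢v : u ≢ v) where
  open Large D tour k out≥ in≥ t t≥2 n≥ public
  module ReverseLarge = Large (reverse-digraph D) (reverse-tournament D tour) k in≥ out≥ t t≥2 n≥

  -- Exchanging u and v exchanges γ and C.
  α β γ C : VSet n
  α = Out u ∩ Out v
  β = In u ∩ In v
  γ = Out u ∩ In v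
  C = Out v ∩ In u

  Covers : List (List V) → Set
  Covers ss = ∀ x → x ∈ˢ C → x ∈ concat ss

  free : List (List V) → VSet n
  free ss = γ ∩ ∁ ⟦ concat ss ⟧

  add-path : ∀ {ss xs} → System u v ss → xs ≢ [] → Linked _⟶_ (u ∷ xs ++ [ v ]) → Unique xs →
    (∀ {x} → x ∈ xs → x ∉ u ∷ v ∷ concat ss) → System u v (xs ∷ ss)
  add-path {ss} {xs} sys xs≢[] l uniq fresh = record
    { nonempty = xs≢[] ∷ System.nonempty sys
    ; linked   = l ∷ System.linked sys
    ; unique   = Unique-resp-↭ (shifts xs (u ∷ v ∷ []))
        (Unique.++⁺ uniq (System.unique sys) λ { (x∈xs , x∈ss) → fresh x∈xs x∈ss }) }

  off-ends : ∀ {x} → x ≢ u → x ≢ v → ∀ {xs} → x ∉ xs → x ∉ u ∷ v ∷ xs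
  off-ends x≢u x≢v x∉ (here x≡u)         = x≢u x≡u
  off-ends x≢u x≢v x∉ (there (here x≡v)) = x≢v x≡v
  off-ends x≢u x≢v x∉ (there (there x∈)) = x∉ x∈

  fresh-pair : ∀ ss → System u v ss → Covers ss → ∣ free ss ∣ˢ ≤ 0 → length (concat ss) ≤ 2 * t + k →
    ∃[ a ] ∃[ b ] (a ∈ˢ α ∩ ∁ ⟦ concat ss ⟧ × b ∈ˢ β ∩ ∁ ⟦ concat ss ⟧ × a ⟶ b)
  fresh-pair ss sys covers none short with any?
      (λ a → any? λ b → mem? (α ∩ ∁ ⟦ concat ss ⟧) a ×-dec mem? (β ∩ ∁ ⟦ concat ss ⟧) b ×-dec (a ⟶? b))
  ... | yes found = found
  ... | no ¬found = ⊥-elim (≤-⊥ 1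
    (+-mono-≤ (+-mono-≤ (cut-bound X Y W (proj₂ someX) (proj₂ someY) X-closed Y-closed)
        (*-monoʳ-≤ 4 (card-list ws)))
      (+-mono-≤ (+-mono-≤ G≥ XYG≤n) (+-mono-≤ (*-monoʳ-≤ 3 short) n≥)))
          (eq n k t ∣ X ∣ˢ ∣ Y ∣ˢ ∣ W ∣ˢ (length ws) ∣ G ∣ˢ))
    where
    ws = concat ss
    W X Y G : VSet n
    W = ⟦ ws ⟧
    X = α ∩ ∁ W
    Y = β ∩ ∁ W
    G = ⟦ u ∷ v ∷ ws ⟧
    no-free : ∀ {x} → u ⟶ x → x ⟶ v → x ∈ˢ W
    no-free {x} u→x x→v = decidable-stable (mem? W x) λ x∉ → contradiction
      (≤-trans (card-unique (free ss) ([] ∷ []) λ { (here refl) → (u→x , x→v) , x∉ }) none) λ ()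
    X-closed : ∀ {a b} → a ∈ˢ X → a ⟶ b → b ∈ˢ X ⊎ b ∈ˢ W
    X-closed {a} {b} ((u→a , v→a) , a∉) a→b with mem? W b
    ... | yes b∈W = inj₂ b∈W
    ... | no b∉W with total {u} {b} (λ { refl → asym u→a a→b }) | total {v} {b} (λ { refl → asym v→a a→b })
    ...   | inj₁ u→b | inj₁ v→b = inj₁ ((u→b , v→b) , b∉W)
    ...   | inj₁ u→b | inj₂ b→v = inj₂ (no-free u→b b→v)
    ...   | inj₂ b→u | inj₁ v→b = inj₂ (covers _ (v→b , b→u))
    ...   | inj₂ b→u | inj₂ b→v = ⊥-elim (¬found (a , b , ((u→a , v→a) , a∉) , ((b→u , b→v) , b∉W) , a→b))
    Y-closed : ∀ {a b} → b ∈ˢ Y → a ⟶ b → a ∈ˢ Y ⊎ a ∈ˢ W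
    Y-closed {a} {b} ((b→u , b→v) , b∉) a→b with mem? W a
    ... | yes a∈W = inj₂ a∈W
    ... | no a∉W with total {u} {a} (λ { refl → asym a→b b→u }) | total {v} {a} (λ { refl → asym a→b b→v })
    ...   | inj₂ a→u | inj₂ a→v = inj₁ ((a→u , a→v) , a∉W)
    ...   | inj₁ u→a | inj₂ a→v = inj₂ (no-free u→a a→v)
    ...   | inj₂ a→u | inj₁ v→a = inj₂ (covers _ (v→a , a→u))
    ...   | inj₁ u→a | inj₁ v→a = ⊥-elim (¬found (a , b , ((u→a , v→a) , a∉W) , ((b→u , b→v) , b∉) , a→b))
    outs : ∣ Out u ∣ˢ ≤ 1 + (∣ X ∣ˢ + length ws)
    outs = ≤-trans (card-cover (Out u) ⟦ [ v ] ⟧ (X ∪ W) split)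
      (+-mono-≤ (card-list [ v ]) (≤-trans (card-cover (X ∪ W) X W id) (+-monoʳ-≤ ∣ X ∣ˢ (card-list ws))))
      where
      split : ∀ {x} → u ⟶ x → x ∈ˢ ⟦ [ v ] ⟧ ⊎ x ∈ˢ X ∪ W
      split {x} u→x with x ≟ᶠ v | mem? W x
      ... | yes refl | _ = inj₁ (here refl)
      ... | no _ | yes x∈W = inj₂ (inj₂ x∈W)
      ... | no x≢v | no x∉W with total x≢v
      ...   | inj₁ x→v = inj₂ (inj₂ (no-free u→x x→v))
      ...   | inj₂ v→x = inj₂ (inj₁ ((u→x , v→x) , x∉W))
    ins : ∣ In v ∣ˢ ≤ 1 + (∣ Y ∣ˢ + length ws)
    ins = ≤-trans (card-cover (In v) ⟦ [ u ] ⟧ (Y ∪ W) split)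
      (+-mono-≤ (card-list [ u ]) (≤-trans (card-cover (Y ∪ W) Y W id) (+-monoʳ-≤ ∣ Y ∣ˢ (card-list ws))))
      where
      split : ∀ {x} → x ⟶ v → x ∈ˢ ⟦ [ u ] ⟧ ⊎ x ∈ˢ Y ∪ W
      split {x} x→v with x ≟ᶠ u | mem? W x
      ... | yes refl | _ = inj₁ (here refl)
      ... | no _ | yes x∈W = inj₂ (inj₂ x∈W)
      ... | no x≢u | no x∉W with total x≢u
      ...   | inj₁ x→u = inj₂ (inj₁ ((x→u , x→v) , x∉W))
      ...   | inj₂ u→x = inj₂ (inj₂ (no-free u→x x→v))
    some : ∀ {d} Z → n ≤ 1 + k + 2 * d → d ≤ 1 + (∣ Z ∣ˢ + length ws) → ∃[ x ] x ∈ˢ Z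
    some {d} Z n≤ d≤ = card-nonempty Z (≰⇒> λ Z≤0 → ≤-⊥ (2 * k)
      (+-mono-≤ (+-mono-≤ n≤ (*-monoʳ-≤ 2 d≤))
          (+-mono-≤ (+-mono-≤ n≥ (*-monoʳ-≤ 2 Z≤0)) (+-mono-≤ (*-monoʳ-≤ 2 short) (*-monoʳ-≤ 2 t≥2))))
      (eq′ n k t d ∣ Z ∣ˢ (length ws)))
      where
      eq′ : ∀ n k t d Z w → n + 2 * d + (6 * t + 5 * k + 2 * Z + (2 * w + 2 * 2))
        ≡ 1 + k + 2 * d + 2 * (1 + (Z + w)) + (n + 2 * 0 + (2 * (2 * t + k) + 2 * t)) + 1 + 2 * k
      eq′ = solve-∀
    someX : ∃[ x ] x ∈ˢ X
    someX = some X (out≥ u) outs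
    someY : ∃[ x ] x ∈ˢ Y
    someY = some Y (in≥ v) ins
    G≥ : 2 + length ws ≤ ∣ G ∣ˢ
    G≥ = card-unique G (System.unique sys) id
    XYG≤n : ∣ X ∣ˢ + ∣ Y ∣ˢ + ∣ G ∣ˢ ≤ n
    XYG≤n = ≤-trans (+-monoˡ-≤ ∣ G ∣ˢ (card-∪ X Y λ { ((u→x , _) , _) ((x→u , _) , _) → asym u→x x→u }))
      (≤-trans (card-∪ (X ∪ Y) G disjoint) (card-≤n _))
      where
      disjoint : ∀ {x} → x ∈ˢ X ∪ Y → x ∉ˢ G
      disjoint (inj₁ ((u→u , _) , _)) (here refl)         = noLoop u→u
      disjoint (inj₁ ((_ , v→v) , _)) (there (here refl)) = noLoop v→v
      disjoint (inj₁ (_ , x∉))        (there (there x∈))  = x∉ x∈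
      disjoint (inj₂ ((u→u , _) , _)) (here refl)         = noLoop u→u
      disjoint (inj₂ ((_ , v→v) , _)) (there (here refl)) = noLoop v→v
      disjoint (inj₂ (_ , x∉))        (there (there x∈))  = x∉ x∈
    eq : ∀ n k t X Y W w G → 2 * n + 4 * W + (2 + w + (X + Y + G) + (3 * w + (6 * t + 5 * k)))
      ≡ 2 * k + (X + Y + 4 * W) + 4 * w + (G + n + (3 * (2 * t + k) + n)) + 1 + 1
    eq = solve-∀

  Grown : ℕ → List (List V) → Set
  Grown m ss = ∃[ ss′ ] (System u v ss′ × Covers ss′ × length ss′ ≡ m + length ss)

  -- Either enough free vertices of γ remain to be used as one-vertex paths, or the
  -- total length stays below 2 t + k whenever an arc from α to β is needed.
  grow : ∀ m ss → System u v ss → Covers ss →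
    m ≤ ∣ free ss ∣ˢ ⊎ length (concat ss) + 2 * m ≤ 2 * t + k + 2 + ∣ free ss ∣ˢ →
    Grown m ss
  grow zero    ss sys covers budget = ss , sys , covers , refl
  grow (suc m) ss sys covers budget with any? (mem? (free ss))
  ... | yes (x , x-free@((u→x , x→v) , x∉)) = finish (grow m ([ x ] ∷ ss) sys′ (λ x → there ∘ covers x) budget′)
    where
    sys′ : System u v ([ x ] ∷ ss)
    sys′ = add-path sys (λ ()) (u→x ∷ x→v ∷ [-]) ([] ∷ [])
      λ { (here refl) → off-ends (arc-≢ u→x ∘ sym) (arc-≢ x→v) x∉ }
    finish : Grown m ([ x ] ∷ ss) → Grown (suc m) ss
    finish (ss′ , s , c , len) = ss′ , s , c , trans len (+-suc m _)
    one-less : ∣ free ss ∣ˢ ≤ 1 + ∣ free ([ x ] ∷ ss) ∣ˢ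
    one-less = ≤-trans (card-cover (free ss) ⟦ [ x ] ⟧ (free ([ x ] ∷ ss)) split)
        (+-monoˡ-≤ _ (card-list [ x ]))
      where
      split : ∀ {y} → y ∈ˢ free ss → y ∈ˢ ⟦ [ x ] ⟧ ⊎ y ∈ˢ free ([ x ] ∷ ss)
      split {y} (y∈γ , y∉) with y ≟ᶠ x
      ... | yes refl = inj₁ (here refl)
      ... | no y≢x   = inj₂ (y∈γ , λ { (here y≡x) → y≢x y≡x ; (there y∈) → y∉ y∈ })
    -- The new path adds one vertex and lowers `2 m` by two, while at most one free vertex is lost,
    -- so either alternative survives.
    budget′ : m ≤ ∣ free ([ x ] ∷ ss) ∣ˢ ⊎ suc (length (concat ss)) + 2 * m ≤ 2 * t + k + 2 + ∣ free
        ([ x ] ∷ ss) ∣ˢ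
    budget′ = [ (λ m< → inj₁ (s≤s⁻¹ (≤-trans m< one-less))) ,
      (λ b → inj₂ (linear (1 + length (concat ss) + 2 * m) (2 * t + k + 2 + ∣ free ([ x ] ∷ ss) ∣ˢ) 0
          (+-mono-≤ b one-less)
        (eq (length (concat ss)) m t k ∣ free ss ∣ˢ ∣ free ([ x ] ∷ ss) ∣ˢ))) ]′ budget
      where
      eq : ∀ w m t k f f′ → w + 2 * (1 + m) + f + (2 * t + k + 2 + f′) ≡ 2 * t + k + 2 + f + (1 + f′) +
          (1 + w + 2 * m) + 0
      eq = solve-∀
  ... | no ¬free = from-budget budget
    where
    none : ∣ free ss ∣ˢ ≤ 0
    none = card-empty {S = free ss} λ x∈ → ¬free (_ , x∈)
    from-budget : suc m ≤ ∣ free ss ∣ˢ ⊎ length (concat ss) + 2 * suc m ≤ 2 * t + k + 2 + ∣ free ss ∣ˢ →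
      Grown (suc m) ss
    from-budget (inj₁ m<) = contradiction (≤-trans m< none) λ ()
    from-budget (inj₂ b) with fresh-pair ss sys covers none short
      where
      -- The summand `2` in the budget pays for the two vertices of the path about to be added.
      short : length (concat ss) ≤ 2 * t + k
      short = linear (length (concat ss)) (2 * t + k) (2 * m) (+-mono-≤ b none)
          (eq (length (concat ss)) m t k ∣ free ss ∣ˢ)
        where
        eq : ∀ w m t k f → w + 2 * (1 + m) + f + (2 * t + k) ≡ 2 * t + k + 2 + f + 0 + w + 2 * m
        eq = solve-∀
    ... | a , b′ , ((u→a , v→a) , a∉) , ((b→u , b→v) , b∉) , a→b
      with grow m ((a ∷ b′ ∷ []) ∷ ss) sys′ (λ x → there ∘ there ∘ covers x) (inj₂ budget′)
      where
      sys′ : System u v ((a ∷ b′ ∷ []) ∷ ss)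
      sys′ = add-path sys (λ ()) (u→a ∷ a→b ∷ b→v ∷ [-]) ((arc-≢ a→b ∷ []) ∷ [] ∷ [])
        λ { (here refl) → off-ends (arc-≢ u→a ∘ sym) (arc-≢ v→a ∘ sym) a∉ ; (there (here refl)) → off-ends
            (arc-≢ b→u) (arc-≢ b→v) b∉ }
      budget′ : 2 + length (concat ss) + 2 * m ≤ 2 * t + k + 2 + ∣ free ((a ∷ b′ ∷ []) ∷ ss) ∣ˢ
      budget′ = linear (2 + length (concat ss) + 2 * m) (2 * t + k + 2 + ∣ free ((a ∷ b′ ∷ []) ∷ ss) ∣ˢ)
          (∣ free ((a ∷ b′ ∷ []) ∷ ss) ∣ˢ)
        (+-mono-≤ b none) (eq (length (concat ss)) m t k ∣ free ss ∣ˢ ∣ free ((a ∷ b′ ∷ []) ∷ ss) ∣ˢ)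
        where
        eq : ∀ w m t k f f′ → w + 2 * (1 + m) + f + (2 * t + k + 2 + f′) ≡ 2 * t + k + 2 + f + 0 +
            (2 + w + 2 * m) + f′
        eq = solve-∀
    ...   | ss′ , s , c , len = ss′ , s , c , trans len (+-suc m _)

  -- Routes joining the ends to a path through `C`

  data InRoute (c : V) : List V → Set where
    direct : ∀ {a} → u ⟶ a → a ≢ v → a ⟶ c → InRoute c [ a ]
    via    : ∀ {a d} → u ⟶ a → a ⟶ d → d ⟶ c → d ⟶ u → d ⟶ v → InRoute c (a ∷ d ∷ [])

  data OutRoute (c : V) : List V → Set where
    direct : ∀ {b} → c ⟶ b → b ⟶ v → b ≢ u → OutRoute c [ b ]
    via    : ∀ {e b} → c ⟶ e → e ⟶ b → b ⟶ v → u ⟶ e → v ⟶ e → OutRoute c (e ∷ b ∷ [])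

  Interior : V → Set
  Interior z = z ≢ u × z ≢ v × z ∉ˢ C

  in-interior : ∀ {c s} → InRoute c s → ∀ {z} → z ∈ s → Interior z
  in-interior (direct u→a a≢v _) (here refl) = arc-≢ u→a ∘ sym , a≢v , λ { (_ , a→u) → asym u→a a→u }
  in-interior (via u→a a→d _ _ d→v) (here refl) =
    arc-≢ u→a ∘ sym , (λ { refl → asym a→d d→v }) , λ { (_ , a→u) → asym u→a a→u }
  in-interior (via _ _ _ d→u d→v) (there (here refl)) = arc-≢ d→u , arc-≢ d→v , λ { (v→d , _) → asym v→d d→v }

  out-interior : ∀ {c s} → OutRoute c s → ∀ {z} → z ∈ s → Interior z
  out-interior (direct _ b→v b≢u) (here refl) = b≢u , arc-≢ b→v , λ { (v→b , _) → asym v→b b→v }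
  out-interior (via _ _ _ u→e v→e) (here refl) = arc-≢ u→e ∘ sym , arc-≢ v→e ∘ sym ,
      λ { (_ , e→u) → asym u→e e→u }
  out-interior (via _ e→b b→v u→e _) (there (here refl)) =
    (λ { refl → asym u→e e→b }) , arc-≢ b→v , λ { (v→b , _) → asym v→b b→v }

  in-unique : ∀ {c s} → InRoute c s → Unique s
  in-unique (direct _ _ _)      = [] ∷ []
  in-unique (via _ a→d _ _ _) = (arc-≢ a→d ∷ []) ∷ [] ∷ []

  out-unique : ∀ {c s} → OutRoute c s → Unique s
  out-unique (direct _ _ _)    = [] ∷ []
  out-unique (via _ e→b _ _ _) = (arc-≢ e→b ∷ []) ∷ [] ∷ []

  in-linked : ∀ {c s r} → InRoute c s → Linked _⟶_ (c ∷ r) → Linked _⟶_ (u ∷ s ++ c ∷ r)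
  in-linked (direct u→a _ a→c)      l = u→a ∷ a→c ∷ l
  in-linked (via u→a a→d d→c _ _) l = u→a ∷ a→d ∷ d→c ∷ l

  out-linked : ∀ {c s} → OutRoute c s → Linked _⟶_ (c ∷ s ++ [ v ])
  out-linked (direct c→b b→v _)      = c→b ∷ b→v ∷ [-]
  out-linked (via c→e e→b b→v _ _) = c→e ∷ e→b ∷ b→v ∷ [-]

  γ-in : List V → ℕ
  γ-in s = ∣ γ ∩ ⟦ s ⟧ ∣ˢ

  γ-in-list : ∀ s xs → (∀ {z} → z ∈ˢ γ → z ∈ s → z ∈ xs) → γ-in s ≤ length xs
  γ-in-list s xs h = card-≤list (γ ∩ ⟦ s ⟧) xs λ { (z∈γ , z∈s) → h z∈γ z∈s }

  -- The second vertex of `via` lies in `β`, hence not in `γ`. Vertices of `γ` are counted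
  -- separately because each one taken by a route is lost as a one-vertex path.
  in-cost : ∀ {c s} → InRoute c s → length s ≤ 2 × γ-in s ≤ 1
  in-cost (direct {a} _ _ _) = s≤s z≤n , γ-in-list _ [ a ] λ _ z∈ → z∈
  in-cost (via {a} _ _ _ d→u _) = ≤-refl ,
    γ-in-list _ [ a ] λ { _ (here refl) → here refl ; (u→d , _) (there (here refl)) → ⊥-elim (asym u→d d→u) }

  out-cost : ∀ {c s} → OutRoute c s → length s ≤ 2 × γ-in s ≤ 1
  out-cost (direct {b} _ _ _) = s≤s z≤n , γ-in-list _ [ b ] λ _ z∈ → z∈
  out-cost (via {e} {b} _ _ _ _ v→e) = ≤-refl ,
    γ-in-list _ [ b ] λ { (_ , e→v) (here refl) → ⊥-elim (asym e→v v→e) ; _ (there (here refl)) → here refl }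

  final : V → List V → V
  final c []       = c
  final c (d ∷ ds) = final d ds

  final-∈ : ∀ c cs → final c cs ∈ c ∷ cs
  final-∈ c []       = here refl
  final-∈ c (d ∷ ds) = there (final-∈ d ds)

  append : ∀ c cs {w} → Linked _⟶_ (c ∷ cs) → Linked _⟶_ (final c cs ∷ w) → Linked _⟶_ (c ∷ cs ++ w)
  append c []       l         l′ = l′
  append c (d ∷ ds) (c→d ∷ l) l′ = c→d ∷ append d ds l l′

  private
    degree-part : ∀ (S P Q : VSet n) {x} → 1 + 2 * ∣ S ∣ˢ ≤ n + k → x ∈ˢ S → P ⊆ˢ S → Q ⊆ˢ S →
      x ∉ˢ P → x ∉ˢ Q → (∀ {y} → y ∈ˢ P → y ∉ˢ Q) → 1 + 2 * (1 + (∣ P ∣ˢ + ∣ Q ∣ˢ)) ≤ n + k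
    degree-part S P Q {x} bound x∈S P⊆S Q⊆S x∉P x∉Q P#Q = ≤-trans (s≤s (*-monoʳ-≤ 2 (≤-trans
      (+-mono-≤ (≤-reflexive (sym (card-singleton x))) (card-∪ P Q P#Q))
      (card-disjoint ⟨ _≟ᶠ x ⟩ (P ∪ Q) S (λ { refl → x∈S }) [ P⊆S , Q⊆S ]′ λ { refl → [ x∉P , x∉Q ]′ })))) bound

  all-vertices : n ≤ 2 + (∣ α ∣ˢ + ∣ β ∣ˢ + (∣ γ ∣ˢ + ∣ C ∣ˢ))
  all-vertices = ≤-trans (≤-reflexive (sym card-full)) (≤-trans
    (card-cover full ⟦ u ∷ v ∷ [] ⟧ ((α ∪ β) ∪ (γ ∪ C)) split)
    (+-mono-≤ (card-list (u ∷ v ∷ [])) (≤-trans (card-cover _ (α ∪ β) (γ ∪ C) id)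
      (+-mono-≤ (card-cover _ α β id) (card-cover _ γ C id)))))
    where
    split : ∀ {x} → x ∈ˢ full → x ∈ u ∷ v ∷ [] ⊎ x ∈ˢ (α ∪ β) ∪ (γ ∪ C)
    split {x} _ with x ≟ᶠ u | x ≟ᶠ v
    ... | yes x≡u | _       = inj₁ (here x≡u)
    ... | no _    | yes x≡v = inj₁ (there (here x≡v))
    ... | no x≢u  | no x≢v with total (x≢u ∘ sym) | total x≢v
    ...   | inj₁ u→x | inj₁ x→v = inj₂ (inj₂ (inj₁ (u→x , x→v)))
    ...   | inj₁ u→x | inj₂ v→x = inj₂ (inj₁ (inj₁ (u→x , v→x)))
    ...   | inj₂ x→u | inj₁ x→v = inj₂ (inj₁ (inj₂ (x→u , x→v)))
    ...   | inj₂ x→u | inj₂ v→x = inj₂ (inj₂ (inj₂ (v→x , x→u)))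

  private
    -- Serves with the sizes of `C` and `γ` when `v ⟶ u`, and with the roles exchanged when `u ⟶ v`.
    -- The arc itself uses up one outdegree at its tail and one indegree at its head, which yields
    -- the `1` gained.
    tip : ∀ c g → 1 + 2 * (1 + (∣ α ∣ˢ + c)) ≤ n + k → 1 + 2 * (1 + (∣ β ∣ˢ + c)) ≤ n + k →
      n ≤ 2 + (∣ α ∣ˢ + ∣ β ∣ˢ + (c + g)) → 1 + c ≤ g + k
    tip c g h₁ h₂ h₃ = *-cancelˡ-≤ 2 (linear (2 * (1 + c)) (2 * (g + k)) 0
      (+-mono-≤ (+-mono-≤ h₁ h₂) (*-monoʳ-≤ 2 h₃)) (eq n k ∣ α ∣ˢ ∣ β ∣ˢ c g))
      where
      eq : ∀ n k a b c g → 1 + 2 * (1 + (a + c)) + (1 + 2 * (1 + (b + c))) + 2 * n + 2 * (g + k)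
        ≡ n + k + (n + k) + 2 * (2 + (a + b + (c + g))) + 2 * (1 + c) + 0
      eq = solve-∀

  -- The arc between u and v tips the balance between γ and C when k = 0.
  balance : ∣ C ∣ˢ ≤ ∣ γ ∣ˢ → 1 + ∣ C ∣ˢ ≤ ∣ γ ∣ˢ + k
  balance C≤γ with total u≢v
  ... | inj₂ v→u = tip ∣ C ∣ˢ ∣ γ ∣ˢ
    (degree-part (Out v) α C (out≤ v) v→u proj₂ proj₁ (noLoop ∘ proj₁) (noLoop ∘ proj₂)
        λ { (u→x , _) (_ , x→u) → asym u→x x→u })
    (degree-part (In u) β C (in≤ u) v→u proj₁ proj₂ (noLoop ∘ proj₂) (noLoop ∘ proj₁)
        λ { (_ , x→v) (v→x , _) → asym v→x x→v })
    (≤-trans all-vertices (≤-reflexive (cong (λ e → 2 + (∣ α ∣ˢ + ∣ β ∣ˢ + e)) (+-comm ∣ γ ∣ˢ ∣ C ∣ˢ))))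
  -- Here `tip` bounds `γ` by `C`, so `C≤γ` is applied on both sides of it.
  ... | inj₁ u→v = ≤-trans (s≤s C≤γ) (≤-trans (tip ∣ γ ∣ˢ ∣ C ∣ˢ
    (degree-part (Out u) α γ (out≤ u) u→v proj₁ proj₁ (noLoop ∘ proj₂) (noLoop ∘ proj₂)
        λ { (_ , v→x) (_ , x→v) → asym v→x x→v })
    (degree-part (In v) β γ (in≤ v) u→v proj₂ proj₂ (noLoop ∘ proj₁) (noLoop ∘ proj₁)
        λ { (x→u , _) (u→x , _) → asym u→x x→u })
    all-vertices) (+-monoˡ-≤ k C≤γ))

  -- The case of small `γ`

  module _ (ω : ℕ) (ω≤t : ω ≤ t) (C≤γ : ∣ C ∣ˢ ≤ ∣ γ ∣ˢ) (γ≤ : 2 * ∣ γ ∣ˢ ≤ 2 * ω + ∣ C ∣ˢ) where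

    C≤2t : ∣ C ∣ˢ ≤ 2 * t
    C≤2t = linear ∣ C ∣ˢ (2 * t) 0 (+-mono-≤ (+-mono-≤ (*-monoʳ-≤ 2 C≤γ) γ≤) (*-monoʳ-≤ 2 ω≤t))
        (eq ∣ C ∣ˢ ∣ γ ∣ˢ ω t)
      where
      eq : ∀ c g ω t → 2 * c + 2 * g + 2 * ω + 2 * t ≡ 2 * g + (2 * ω + c) + 2 * t + c + 0
      eq = solve-∀

    -- The constant 5 is what `grow` leaves for the routes. It asks for
    -- `length + 2 (ω - 1) ≤ 2 t + k + 2 + free`; the length is `∣ C ∣` plus that of the routes,
    -- `free` is at least `∣ γ ∣` minus the vertices of `γ` on them, and `balance` gives
    -- `1 + ∣ C ∣ ≤ ∣ γ ∣ + k`. If `∣ γ ∣ > ω`, the routes take at most two vertices of `γ` and the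
    -- other `ω - 1` paths can be single vertices.
    record Routes (c₁ c₂ : V) : Set where
      constructor routes
      field
        {pre post} : List V
        in-route   : InRoute c₁ pre
        out-route  : OutRoute c₂ post
        disjoint   : ∀ {z} → z ∈ pre → z ∉ post
        cheap      : ∣ γ ∣ˢ ≤ ω → length pre + γ-in pre + (length post + γ-in post) ≤ 5

    budget₁ : ∀ {x y} → x ≤ 1 → y ≤ 1 → 2 * ∣ C ∣ˢ + 2 * x + 4 * y ≤ 6 * t + 4 × 2 * ∣ C ∣ˢ + 2 * x + 2 ≤ 6 * t
    budget₁ {x} {y} x≤1 y≤1 =
      linear (2 * c + 2 * x + 4 * y) (6 * t + 4) 2
          (+-mono-≤ (+-mono-≤ (*-monoʳ-≤ 2 C≤2t) (*-monoʳ-≤ 2 t≥2))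
          (+-mono-≤ (*-monoʳ-≤ 2 x≤1) (*-monoʳ-≤ 4 y≤1))) (eq₁ c t x y) ,
      linear (2 * c + 2 * x + 2) (6 * t) 0
          (+-mono-≤ (+-mono-≤ (*-monoʳ-≤ 2 C≤2t) (*-monoʳ-≤ 2 t≥2)) (*-monoʳ-≤ 2 x≤1)) (eq₂ c t x)
      where
      c = ∣ C ∣ˢ
      eq₁ : ∀ c t x y → 2 * c + 2 * 2 + (2 * x + 4 * y) + (6 * t + 4) ≡ 2 * (2 * t) + 2 * t +
          (2 * 1 + 4 * 1) + (2 * c + 2 * x + 4 * y) + 2
      eq₁ = solve-∀
      eq₂ : ∀ c t x → 2 * c + 2 * 2 + 2 * x + 6 * t ≡ 2 * (2 * t) + 2 * t + 2 * 1 + (2 * c + 2 * x + 2) + 0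
      eq₂ = solve-∀

    -- The first inequality is an equality for `t = 2`, `∣ C ∣ = 4` and `y = 2`.
    budget₂ : ∀ {x y} → x ≤ 0 → y ≤ 2 → 2 * ∣ C ∣ˢ + 2 * x + 4 * y ≤ 6 * t + 4 × 2 * ∣ C ∣ˢ + 2 * x + 2 ≤ 6 * t
    budget₂ {x} {y} x≤0 y≤2 =
      linear (2 * c + 2 * x + 4 * y) (6 * t + 4) 0
          (+-mono-≤ (+-mono-≤ (*-monoʳ-≤ 2 C≤2t) (*-monoʳ-≤ 2 t≥2))
          (+-mono-≤ (*-monoʳ-≤ 2 x≤0) (*-monoʳ-≤ 4 y≤2))) (eq₁ c t x y) ,
      proj₂ (budget₁ {x} {0} (≤-trans x≤0 z≤n) z≤n)
      where
      c = ∣ C ∣ˢ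
      eq₁ : ∀ c t x y → 2 * c + 2 * 2 + (2 * x + 4 * y) + (6 * t + 4) ≡ 2 * (2 * t) + 2 * t +
          (2 * 0 + 4 * 2) + (2 * c + 2 * x + 4 * y) + 0
      eq₁ = solve-∀

    budget₃ : ∣ γ ∣ˢ ≤ ω → 2 * ∣ C ∣ˢ + 2 * 0 + 4 * ∣ γ ∣ˢ ≤ 6 * t + 4
    budget₃ γ≤ω = linear (2 * c + 2 * 0 + 4 * g) (6 * t + 4) 4
        (+-mono-≤ (*-monoʳ-≤ 2 C≤γ) (*-monoʳ-≤ 6 (≤-trans γ≤ω ω≤t))) (eq c t g)
      where
      c = ∣ C ∣ˢ
      g = ∣ γ ∣ˢ
      eq : ∀ c t g → 2 * c + 6 * g + (6 * t + 4) ≡ 2 * g + 6 * t + (2 * c + 2 * 0 + 4 * g) + 4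
      eq = solve-∀

    module _ {c₁ c₂ : V} (c₁∈C : c₁ ∈ˢ C) (c₂∈C : c₂ ∈ˢ C) where

      enter : ∀ X Y x y → ∣ X ∩ In c₁ ∣ˢ ≤ x → ∣ Y ∩ Out u ∣ˢ ≤ y →
        2 * ∣ C ∣ˢ + 2 * x + 4 * y ≤ 6 * t + 4 × 2 * ∣ C ∣ˢ + 2 * x + 2 ≤ 6 * t →
        ∃[ s ] (InRoute c₁ s × ((∃[ a ] (s ≡ [ a ] × a ∉ˢ X)) ⊎
            (∃[ a ] ∃[ d ] (s ≡ a ∷ d ∷ [] × a ∉ˢ Y × d ∉ˢ X))))
      enter X Y x y x≤ y≤ (h₁ , h₂) with connect-in u v (proj₁ c₁∈C) (proj₂ c₁∈C) X Y ∣ C ∣ˢ x y ≤-refl x≤ y≤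
          h₁ h₂
      ... | inj₁ (a , u→a , a≢v , a→c , a∉X) = [ a ] , direct u→a a≢v a→c , inj₁ (a , refl , a∉X)
      ... | inj₂ (a , d , (u→a , a∉Y) , a→d , d→c , d→u , d→v , d∉X) =
        a ∷ d ∷ [] , via u→a a→d d→c d→u d→v , inj₂ (a , d , refl , a∉Y , d∉X)

      leave : ∀ X x y → ∣ X ∩ Out c₂ ∣ˢ ≤ x → ∣ X ∩ In v ∣ˢ ≤ y →
        2 * ∣ C ∣ˢ + 2 * x + 4 * y ≤ 6 * t + 4 × 2 * ∣ C ∣ˢ + 2 * x + 2 ≤ 6 * t →
        ∃[ s ] (OutRoute c₂ s × (∀ {z} → z ∈ s → z ∉ˢ X))
      leave X x y x≤ y≤ (h₁ , h₂) with ReverseLarge.connect-in v u (proj₂ c₂∈C) (proj₁ c₂∈C) X X ∣ C ∣ˢ x y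
                                          (card-⊆ _ C λ { (x→u , v→x) → v→x , x→u }) x≤ y≤ h₁ h₂
      ... | inj₁ (b , b→v , b≢u , c→b , b∉X) = [ b ] , direct c→b b→v b≢u , λ { (here refl) → b∉X }
      ... | inj₂ (b , e , (b→v , b∉X) , e→b , c→e , v→e , u→e , e∉X) =
        e ∷ b ∷ [] , via c→e e→b b→v u→e v→e , λ { (here refl) → e∉X ; (there (here refl)) → b∉X }

      one : ∀ z {S : VSet n} → ∣ ⟦ [ z ] ⟧ ∩ S ∣ˢ ≤ 1
      one z = card-≤list _ [ z ] proj₁

      cost₅ : ∀ {a b c d} → (a ≤ 1 × b ≤ 1) × (c ≤ 2 × d ≤ 1) ⊎ (c ≤ 1 × d ≤ 1) × (a ≤ 2 × b ≤ 1) ⊎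
          (a ≤ 2 × b ≤ 0) × (c ≤ 2 × d ≤ 1) → a + b + (c + d) ≤ 5
      cost₅ (inj₁ ((a , b) , c , d))        = +-mono-≤ (+-mono-≤ a b) (+-mono-≤ c d)
      cost₅ (inj₂ (inj₁ ((c , d) , a , b))) = +-mono-≤ (+-mono-≤ a b) (+-mono-≤ c d)
      cost₅ (inj₂ (inj₂ ((a , b) , c , d))) = +-mono-≤ (+-mono-≤ a b) (≤-trans (+-mono-≤ c d) ≤-refl)

      Enters : VSet n → VSet n → Set
      Enters X Y = ∃[ s ] (InRoute c₁ s ×
          ((∃[ a ] (s ≡ [ a ] × a ∉ˢ X)) ⊎ (∃[ a ] ∃[ d ] (s ≡ a ∷ d ∷ [] × a ∉ˢ Y × d ∉ˢ X))))

      Leaves : VSet n → Set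
      Leaves X = ∃[ s ] (OutRoute c₂ s × (∀ {z} → z ∈ s → z ∉ˢ X))

      enter-directly : ∀ {a} → InRoute c₁ [ a ] → Routes c₁ c₂
      enter-directly {a} in′ = join (leave ⟦ [ a ] ⟧ 1 1 (one a) (one a) (budget₁ ≤-refl ≤-refl))
        where
        join : Leaves ⟦ [ a ] ⟧ → Routes c₁ c₂
        join (post , out , fresh) = routes in′ out (λ { (here refl) z∈ → fresh z∈ (here refl) })
          λ _ → cost₅ (inj₁ ((≤-refl , proj₂ (in-cost in′)) , out-cost out))

      leave-directly : ∀ {b} → OutRoute c₂ [ b ] → Routes c₁ c₂
      leave-directly {b} out = join (enter ⟦ [ b ] ⟧ ⟦ [ b ] ⟧ 1 1 (one b) (one b) (budget₁ ≤-refl ≤-refl))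
        where
        cheap : ∀ {s} → InRoute c₁ s → length s + γ-in s + (1 + γ-in [ b ]) ≤ 5
        cheap in′ = cost₅ (inj₂ (inj₁ ((≤-refl , proj₂ (out-cost out)) , in-cost in′)))
        join : Enters ⟦ [ b ] ⟧ ⟦ [ b ] ⟧ → Routes c₁ c₂
        join (_ , in′ , inj₁ (_ , refl , a∉)) = routes in′ out (λ { (here refl) → a∉ }) λ _ → cheap in′
        join (_ , in′ , inj₂ (_ , _ , refl , a∉ , d∉)) =
          routes in′ out (λ { (here refl) → a∉ ; (there (here refl)) → d∉ }) λ _ → cheap in′

      module _ (no-enter : ∀ {a} → ¬ InRoute c₁ [ a ]) (no-leave : ∀ {b} → ¬ OutRoute c₂ [ b ]) where

        -- If `a ⟶ v`, then `c₂` dominates neither `a` nor `d`, since either would be a one-vertex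
        -- exit; forbidding both costs nothing at `c₂` and two at `v`. If not, only `a` can count at
        -- `c₂` and only `d` at `v`.
        continue : ∀ {a d} → InRoute c₁ (a ∷ d ∷ []) → (∣ γ ∣ˢ ≤ ω → a ∉ˢ γ) → Routes c₁ c₂
        continue {a} {d} in′@(via u→a a→d d→c d→u d→v) a∉γ = choose (a ⟶? v)
          where
          pre : List V
          pre = a ∷ d ∷ []
          ¬c→d : ¬ c₂ ⟶ d
          ¬c→d c→d = no-leave (direct c→d d→v (arc-≢ d→u))
          join : (∣ γ ∣ˢ ≤ ω → γ-in pre ≤ 0) → Leaves ⟦ pre ⟧ → Routes c₁ c₂
          join free (post , out , fresh) = routes in′ out (λ z∈ z∈′ → fresh z∈′ z∈)
            λ γ≤ω → cost₅ (inj₂ (inj₂ ((≤-refl , free γ≤ω) , out-cost out)))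
          choose : Dec (a ⟶ v) → Routes c₁ c₂
          choose (yes a→v) = join (λ γ≤ω → ⊥-elim (a∉γ γ≤ω (u→a , a→v))) (leave ⟦ pre ⟧ 0 2
            (card-≤list (⟦ pre ⟧ ∩ Out c₂) [] λ
              { (here refl , c→a) → ⊥-elim (no-leave (direct c→a a→v (arc-≢ u→a ∘ sym)))
              ; (there (here refl) , c→d) → ⊥-elim (¬c→d c→d) })
            (card-≤list (⟦ pre ⟧ ∩ In v) pre proj₁) (budget₂ z≤n ≤-refl))
          choose (no ¬a→v) = join
            (λ _ → γ-in-list pre [] λ { (_ , a→v) (here refl) → ⊥-elim (¬a→v a→v) ; (u→d , _)
                (there (here refl)) → ⊥-elim (asym u→d d→u) })
            (leave ⟦ pre ⟧ 1 1
              (card-≤list (⟦ pre ⟧ ∩ Out c₂) [ a ]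
                  λ { (here refl , _) → here refl ; (there (here refl) , c→d) → ⊥-elim (¬c→d c→d) })
              (card-≤list (⟦ pre ⟧ ∩ In v) [ d ]
                  λ { (here refl , a→v) → ⊥-elim (¬a→v a→v) ; (there (here refl) , _) → here refl })
              (budget₁ ≤-refl ≤-refl))

        indirect : Dec (∣ γ ∣ˢ ≤ ω) → Routes c₁ c₂
        -- All of `γ` can be forbidden as first vertex, because `2 ∣ C ∣ + 4 ∣ γ ∣ ≤ 6 ω`.
        indirect (yes γ≤ω) = join (enter ∅ γ 0 ∣ γ ∣ˢ (card-≤list (∅ ∩ In c₁) [] λ ())
            (card-⊆ (γ ∩ Out u) γ proj₁)
            (budget₃ γ≤ω , proj₂ (budget₁ {0} {0} z≤n z≤n)))
          where
          join : Enters ∅ γ → Routes c₁ c₂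
          join (_ , in′ , inj₁ (_ , refl , _))           = ⊥-elim (no-enter in′)
          join (_ , in′ , inj₂ (_ , _ , refl , a∉γ , _)) = continue in′ λ _ → a∉γ
        indirect (no γ≰ω) = join (enter ∅ ∅ 0 0 (card-≤list (∅ ∩ In c₁) [] λ ())
            (card-≤list (∅ ∩ Out u) [] λ ()) (budget₁ z≤n z≤n))
          where
          join : Enters ∅ ∅ → Routes c₁ c₂
          join (_ , in′ , inj₁ (_ , refl , _))     = ⊥-elim (no-enter in′)
          join (_ , in′ , inj₂ (_ , _ , refl , _)) = continue in′ λ γ≤ω → ⊥-elim (γ≰ω γ≤ω)

      -- A one-vertex route costs at most 2 and any route at most 3, vertices of `γ` counting twice.
      -- So one direct route keeps the total at 5, while two long routes might reach 6; `indirect`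
      -- then saves one by entering outside `γ` if `∣ γ ∣ ≤ ω`.
      find-routes : Routes c₁ c₂
      find-routes = choose (any? λ a → (u ⟶? a) ×-dec ¬? (a ≟ᶠ v) ×-dec (a ⟶? c₁))
          (any? λ b → (c₂ ⟶? b) ×-dec (b ⟶? v) ×-dec ¬? (b ≟ᶠ u))
        where
        choose : Dec (∃[ a ] (u ⟶ a × a ≢ v × a ⟶ c₁)) → Dec (∃[ b ] (c₂ ⟶ b × b ⟶ v × b ≢ u)) → Routes c₁ c₂
        choose (yes (_ , u→a , a≢v , a→c)) _ = enter-directly (direct u→a a≢v a→c)
        choose (no _) (yes (_ , c→b , b→v , b≢u)) = leave-directly (direct c→b b→v b≢u)
        choose (no ¬enter) (no ¬leave) = indirect (λ { (direct u→a a≢v a→c) → ¬enter (_ , u→a , a≢v , a→c) })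
          (λ { (direct c→b b→v b≢u) → ¬leave (_ , c→b , b→v , b≢u) }) (∣ γ ∣ˢ ≤? ω)

    few : 1 ≤ ω → ∃[ ss ] (System u v ss × Covers ss × length ss ≡ ω)
    few ω≥1 with hamiltonian-path (Unique.filter⁺ (mem? C) (Unique.allFin⁺ n))
    ... | [] , _ , perm = finish (grow ω [] empty (λ x x∈C → ∈-resp-↭ (↭-sym perm) (∈-elements {S = C} x∈C))
        (inj₂ bound))
      where
      empty : System u v []
      empty = record { nonempty = [] ; linked = [] ; unique = (u≢v ∷ []) ∷ [] ∷ [] }
      finish : Grown ω [] → ∃[ ss ] (System u v ss × Covers ss × length ss ≡ ω)
      finish (ss , sys , cov , len) = ss , sys , cov , trans len (+-identityʳ ω)
      bound : 2 * ω ≤ 2 * t + k + 2 + ∣ free [] ∣ˢ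
      bound = ≤-trans (*-monoʳ-≤ 2 ω≤t)
          (≤-trans (m≤m+n _ (k + 2 + ∣ free [] ∣ˢ)) (≤-reflexive (eq t k ∣ free [] ∣ˢ)))
        where
        eq : ∀ t k f → 2 * t + (k + 2 + f) ≡ 2 * t + k + 2 + f
        eq = solve-∀
    ... | c ∷ cs , linked , perm = finish (find-routes (∈C (here refl)) (∈C (final-∈ c cs)))
      where
      ∈C : ∀ {x} → x ∈ c ∷ cs → x ∈ˢ C
      ∈C x∈ = elements-∈ {S = C} (∈-resp-↭ perm x∈)
      cs-unique : Unique (c ∷ cs)
      cs-unique = Unique-resp-↭ (↭-sym perm) (Unique.filter⁺ (mem? C) (Unique.allFin⁺ n))
      cs-length : length (c ∷ cs) ≡ ∣ C ∣ˢ
      cs-length = trans (↭-length perm) (length-elements C)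
      finish : Routes c (final c cs) → ∃[ ss ] (System u v ss × Covers ss × length ss ≡ ω)
      finish (routes {pre} {post} in′ out pre#post cheap) = extract (grow m [ P ] system covers budget)
        where
        P = pre ++ (c ∷ cs) ++ post
        m = ω ∸ 1
        suc-m : m + 1 ≡ ω
        suc-m = m∸n+n≡m ω≥1
        extract : Grown m [ P ] → ∃[ ss ] (System u v ss × Covers ss × length ss ≡ ω)
        extract (ss , sys , cov , len) = ss , sys , cov , trans len suc-m
        part : ∀ {x} → x ∈ P → x ∈ pre ⊎ x ∈ c ∷ cs ⊎ x ∈ post
        part x∈ with ∈-++⁻ pre x∈
        ... | inj₁ x∈pre = inj₁ x∈pre
        ... | inj₂ x∈′   = inj₂ (∈-++⁻ (c ∷ cs) x∈′)
        P-linked : Linked _⟶_ (u ∷ P ++ [ v ])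
        P-linked = subst (λ l → Linked _⟶_ (u ∷ l))
            (sym (trans (++-assoc pre _ [ v ]) (cong (λ l → pre ++ c ∷ l) (++-assoc cs post [ v ]))))
          (in-linked in′ (append c cs linked (out-linked out)))
        P-unique : Unique P
        P-unique = Unique.++⁺ (in-unique in′) (Unique.++⁺ cs-unique (out-unique out)
            λ { (x∈ , x∈post) → proj₂ (proj₂ (out-interior out x∈post)) (∈C x∈) })
          λ { (x∈pre , x∈) → [ (λ x∈cs → proj₂ (proj₂ (in-interior in′ x∈pre)) (∈C x∈cs)) , pre#post x∈pre ]′
              (∈-++⁻ (c ∷ cs) x∈) }
        off : ∀ {x} → x ∈ P → x ∉ u ∷ v ∷ []
        off x∈ with part x∈
        ... | inj₁ x∈pre = off-ends (proj₁ (in-interior in′ x∈pre)) (proj₁ (proj₂ (in-interior in′ x∈pre))) λ ()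
        ... | inj₂ (inj₁ x∈cs) = off-ends (arc-≢ (proj₂ (∈C x∈cs))) (arc-≢ (proj₁ (∈C x∈cs)) ∘ sym) λ ()
        ... | inj₂ (inj₂ x∈post) = off-ends (proj₁ (out-interior out x∈post))
            (proj₁ (proj₂ (out-interior out x∈post))) λ ()
        system : System u v [ P ]
        system = add-path {[]} record { nonempty = [] ; linked = [] ; unique = (u≢v ∷ []) ∷ [] ∷ [] }
          (λ P≡[] → contradiction (subst (c ∈_) P≡[] (∈-++⁺ʳ pre (here refl))) λ ()) P-linked P-unique off
        covers : Covers [ P ]
        covers x x∈C = ∈-++⁺ˡ (∈-++⁺ʳ pre (∈-++⁺ˡ (∈-resp-↭ (↭-sym perm) (∈-elements {S = C} x∈C))))
        f = ∣ free [ P ] ∣ˢ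
        γ-bound : ∣ γ ∣ˢ ≤ f + (γ-in pre + γ-in post)
        γ-bound = ≤-trans (card-cover γ (free [ P ]) ((γ ∩ ⟦ pre ⟧) ∪ (γ ∩ ⟦ post ⟧)) split)
          (+-monoʳ-≤ f (card-cover _ (γ ∩ ⟦ pre ⟧) (γ ∩ ⟦ post ⟧) id))
          where
          split : ∀ {x} → x ∈ˢ γ → x ∈ˢ free [ P ] ⊎ x ∈ˢ (γ ∩ ⟦ pre ⟧) ∪ (γ ∩ ⟦ post ⟧)
          split {x} x∈γ with x ∈? concat [ P ]
          ... | no x∉ = inj₁ (x∈γ , x∉)
          ... | yes x∈ with part (subst (x ∈_) (++-identityʳ P) x∈)
          ...   | inj₁ x∈pre         = inj₂ (inj₁ (x∈γ , x∈pre))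
          ...   | inj₂ (inj₁ x∈cs)   = ⊥-elim (asym (proj₁ x∈γ) (proj₂ (∈C x∈cs)))
          ...   | inj₂ (inj₂ x∈post) = inj₂ (inj₂ (x∈γ , x∈post))
        P-length : length (concat [ P ]) ≡ length pre + (∣ C ∣ˢ + length post)
        P-length = trans (cong length (++-identityʳ P)) (trans (length-++ pre) (cong (length pre +_)
          (trans (length-++ (c ∷ cs)) (cong (_+ length post) cs-length))))
        budget : m ≤ f ⊎ length (concat [ P ]) + 2 * m ≤ 2 * t + k + 2 + f
        budget with ∣ γ ∣ˢ ≤? ω
        ... | yes γ≤ω = inj₂ (≤-trans (≤-reflexive (cong (_+ 2 * m) P-length))
            (linear (length pre + (∣ C ∣ˢ + length post) + 2 * m) (2 * t + k + 2 + f) 0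
              (+-mono-≤ (+-mono-≤ (cheap γ≤ω) γ-bound)
                  (+-mono-≤ (balance C≤γ) (*-monoʳ-≤ 2 (≤-trans (≤-reflexive suc-m) ω≤t))))
              (eq (length pre) (γ-in pre) (length post) (γ-in post) ∣ γ ∣ˢ ∣ C ∣ˢ f m t k)))
          where
          eq : ∀ p p′ q q′ g c f m t k → p + p′ + (q + q′) + g + (1 + c + 2 * (m + 1)) + (2 * t + k + 2 + f)
            ≡ 5 + (f + (p′ + q′)) + (g + k + 2 * t) + (p + (c + q) + 2 * m) + 0
          eq = solve-∀
        ... | no γ≰ω = inj₁ (linear m f 0
            (+-mono-≤ (+-mono-≤ (≰⇒> γ≰ω) (≤-reflexive suc-m))
                (+-mono-≤ γ-bound (+-mono-≤ (proj₂ (in-cost in′)) (proj₂ (out-cost out)))))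
            (eq ω m ∣ γ ∣ˢ f (γ-in pre) (γ-in post)))
          where
          eq : ∀ ω m g f p q → 1 + ω + (m + 1) + (g + (p + q)) + f ≡ g + ω + (f + (p + q) + (1 + 1)) + m + 0
          eq = solve-∀

  -- Equality k = 0, n = 6 t is excluded because a regular tournament has odd order.
  exceeds : ¬ n ≤ 2 * k + 6 * t
  exceeds n≤ = even≢odd (3 * t) ∣ Out u ∣ˢ (trans (≤-antisym 6t≤ ≤6t) refl)
    where
    k≤0 : k ≤ 0
    k≤0 = *-cancelˡ-≤ 3 (linear (3 * k) 0 0 (+-mono-≤ n≥ n≤) (eq n k t))
      where
      eq : ∀ n k t → 6 * t + 5 * k + n + 0 ≡ n + (2 * k + 6 * t) + 3 * k + 0
      eq = solve-∀
    o = ∣ Out u ∣ˢ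
    6t≤ : 2 * (3 * t) ≤ 1 + 2 * o
    6t≤ = linear (2 * (3 * t)) (1 + 2 * o) (4 * k) (+-mono-≤ n≥ (out≥ u)) (eq n k t o)
      where
      eq : ∀ n k t o → 6 * t + 5 * k + n + (1 + 2 * o) ≡ n + (1 + k + 2 * o) + 2 * (3 * t) + 4 * k
      eq = solve-∀
    ≤6t : 1 + 2 * o ≤ 2 * (3 * t)
    ≤6t = linear (1 + 2 * o) (2 * (3 * t)) 0 (+-mono-≤ (+-mono-≤ n≤ (out≤ u)) (*-monoʳ-≤ 3 k≤0)) (eq n k t o)
      where
      eq : ∀ n k t o → n + (1 + 2 * o) + 3 * k + 2 * (3 * t) ≡ 2 * k + 6 * t + (n + k) + 3 * 0 + (1 + 2 * o) + 0
      eq = solve-∀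

  -- Hamiltonian cycles after deleting at most `2 t` vertices

  module _ (fs : List V) (fs≤ : length fs ≤ 2 * t) where

    N : VSet n
    N = ∁ ⟦ fs ⟧

    -- If no arc led from `X` to the rest of `N`, then `cut-bound` would give
    -- `n ≤ 2 k + 3 ∣ F ∣ ≤ 2 k + 6 t`, exactly what `exceeds` refutes.
    strong : ∀ X {x y} → X ⊆ˢ N → x ∈ˢ X → y ∈ˢ N → y ∉ˢ X → ∃[ a ] ∃[ b ] (a ∈ˢ X × b ∈ˢ N ∩ ∁ X × a ⟶ b)
    strong X X⊆N x∈X y∈N y∉X = choose (any? λ a → any? λ b → mem? X a ×-dec mem? Y b ×-dec (a ⟶? b))
      where
      F Y : VSet n
      F = ⟦ fs ⟧
      Y = N ∩ ∁ X
      choose : Dec (∃[ a ] ∃[ b ] (a ∈ˢ X × b ∈ˢ Y × a ⟶ b)) → ∃[ a ] ∃[ b ] (a ∈ˢ X × b ∈ˢ Y × a ⟶ b)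
      choose (yes found) = found
      choose (no ¬found) = ⊥-elim (exceeds (linear n (2 * k + 6 * t) 0
          (+-mono-≤ (+-mono-≤ (cut-bound X Y F x∈X (y∈N , y∉X) X-closed Y-closed) XYF≤n)
            (*-monoʳ-≤ 3 (≤-trans (card-list fs) fs≤))) (eq n k t ∣ X ∣ˢ ∣ Y ∣ˢ ∣ F ∣ˢ)))
        where
        X-closed : ∀ {a b} → a ∈ˢ X → a ⟶ b → b ∈ˢ X ⊎ b ∈ˢ F
        X-closed {a} {b} a∈X a→b with mem? F b | mem? X b
        ... | yes b∈F | _       = inj₂ b∈F
        ... | no _    | yes b∈X = inj₁ b∈X
        ... | no b∉F  | no b∉X  = ⊥-elim (¬found (a , b , a∈X , (b∉F , b∉X) , a→b))
        Y-closed : ∀ {a b} → b ∈ˢ Y → a ⟶ b → a ∈ˢ Y ⊎ a ∈ˢ F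
        Y-closed {a} {b} b∈Y a→b with mem? F a | mem? X a
        ... | yes a∈F | _       = inj₂ a∈F
        ... | no _    | yes a∈X = ⊥-elim (¬found (a , b , a∈X , b∈Y , a→b))
        ... | no a∉F  | no a∉X  = inj₁ (a∉F , a∉X)
        XYF≤n : ∣ X ∣ˢ + ∣ Y ∣ˢ + ∣ F ∣ˢ ≤ n
        XYF≤n = ≤-trans (+-monoˡ-≤ ∣ F ∣ˢ (card-∪ X Y λ x∈X x∈Y → proj₂ x∈Y x∈X))
          (≤-trans (card-∪ (X ∪ Y) F [ X⊆N , proj₁ ]′) (card-≤n ((X ∪ Y) ∪ F)))
        eq : ∀ n k t X Y F → 2 * n + (X + Y + F) + 3 * F + (2 * k + 6 * t) ≡ 2 * k + (X + Y + 4 * F) + n + 3 *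
            (2 * t) + n + 0
        eq = solve-∀

    record Cycle (z : V) (zs : List V) : Set where
      field
        unique : Unique (z ∷ zs)
        inside : ∀ {x} → x ∈ z ∷ zs → x ∈ˢ N
        closed : zs ≡ [] ⊎ Linked _⟶_ (z ∷ zs ++ [ z ])

    -- Camion's theorem. If no outside vertex is `Insertable`, those dominated by `z` are dominated
    -- by the whole cycle, and the others dominate the whole cycle. An arc `o ⟶ i` from the first
    -- kind to the second gives a detour `z ⟶ o ⟶ i` back into the cycle. Without such an arc,
    -- `strong` is violated by the first kind or, if that is empty, by the cycle itself.
    lengthen : ∀ {z zs} → Cycle z zs → ∀ {x} → x ∈ˢ N → x ∉ z ∷ zs → ∃[ zs′ ]
        (Cycle z zs′ × suc (length zs) ≤ length zs′)
    lengthen {z} {zs} cyc {x} x∈N x∉ = choose (any? λ y → mem? Outside y ×-dec insertable? y)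
        (any? λ o → any? λ i → (mem? Outside o ×-dec mem? Outside i) ×-dec (z ⟶? o) ×-dec (o ⟶? i) ×-dec
            (i ⟶? z))
      where
      open Cycle cyc
      Outside : VSet n
      Outside = N ∩ ∁ ⟦ z ∷ zs ⟧
      Insertable : V → Set
      Insertable y = (z ⟶ y × Any (y ⟶_) zs) ⊎ (y ⟶ z × Any (_⟶ y) zs)
      insertable? : ∀ y → Dec (Insertable y)
      insertable? y = ((z ⟶? y) ×-dec Any.any? (y ⟶?_) zs) ⊎-dec ((y ⟶? z) ×-dec Any.any? (_⟶? y) zs)
      Longer : Set
      Longer = ∃[ zs′ ] (Cycle z zs′ × suc (length zs) ≤ length zs′)
      closed′ : ∀ {P : V → Set} → Any P zs → Linked _⟶_ (z ∷ zs ++ [ z ])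
      closed′ any = [ (λ { refl → contradiction any λ () }) , id ]′ closed
      grown : ∀ {y zs′} → y ∈ˢ Outside → zs′ ↭ y ∷ zs → Linked _⟶_ (z ∷ zs′ ++ [ z ]) → Longer
      grown {y} {zs′} (y∈N , y∉) perm l = zs′ , record
        { unique = Unique-resp-↭ (↭-trans (swap y z ↭-refl) (prep z (↭-sym perm)))
            (All.tabulate (λ { z∈ refl → y∉ z∈ }) ∷ unique)
        ; inside = λ { (here refl) → inside (here refl) ; (there x∈) → inside′ (∈-resp-↭ perm x∈) }
        ; closed = inj₂ l } , ≤-reflexive (sym (↭-length perm))
        where
        inside′ : ∀ {x} → x ∈ y ∷ zs → x ∈ˢ N
        inside′ (here refl) = y∈N
        inside′ (there x∈)  = inside (there x∈)
      insert : ∀ {y} → y ∈ˢ Outside → Insertable y → Longer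
      insert y-out (inj₁ (z→y , any)) with insert-forward zs single (proj₂ y-out ∘ there) z→y (closed′ any)
          (Any.++⁺ˡ any)
      ... | zs′ , _ , which , l , perm with refl ← [ id , id ]′ which = grown y-out perm l
      insert y-out (inj₂ (y→z , any)) with insert-backward zs single (proj₂ y-out ∘ there) y→z (closed′ any)
          (there any)
      ... | zs′ , _ , which , l , perm with refl ← [ id , id ]′ which = grown y-out perm l
      choose : Dec (∃[ y ] (y ∈ˢ Outside × Insertable y)) →
        Dec (∃[ o ] ∃[ i ] ((o ∈ˢ Outside × i ∈ˢ Outside) × z ⟶ o × o ⟶ i × i ⟶ z)) → Longer
      choose (yes (y , y-out , ins)) _ = insert y-out ins
      choose (no ¬ins) (yes (o , i , ((o∈N , o∉) , (i∈N , i∉)) , z→o , o→i , i→z)) = o ∷ i ∷ zs , record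
        { unique = Unique-resp-↭ (shifts (o ∷ i ∷ []) [ z ])
            ((arc-≢ o→i ∷ All.tabulate (λ { x∈ refl → o∉ x∈ })) ∷ All.tabulate (λ { x∈ refl → i∉ x∈ }) ∷ unique)
        ; inside = λ { (here refl) → inside (here refl) ; (there (here refl)) → o∈N ;
            (there (there (here refl))) → i∈N ; (there (there (there x∈))) → inside (there x∈) }
        ; closed = inj₂ (z→o ∷ o→i ∷ into zs
            (λ q∈ → connex (λ { refl → i∉ (there q∈) }) λ q→i → ¬ins
            (i , (i∈N , i∉) , inj₂ (i→z , lose q∈ q→i))) closed) }
        , n≤1+n _
        where
        into : ∀ qs → (∀ {q} → q ∈ qs → i ⟶ q) → qs ≡ [] ⊎ Linked _⟶_ (z ∷ qs ++ [ z ]) → Linked _⟶_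
            (i ∷ qs ++ [ z ])
        into []       _  _                = i→z ∷ [-]
        into (q ∷ qs) i→ (inj₂ (_ ∷ l)) = i→ (here refl) ∷ l
      choose (no ¬ins) (no ¬pair) = ⊥-elim (blocked (any? λ o → mem? Outside o ×-dec (z ⟶? o)))
        where
        O Z : VSet n
        O = Outside ∩ Out z
        Z = ⟦ z ∷ zs ⟧
        blocked : Dec (∃[ o ] o ∈ˢ O) → ⊥
        blocked (yes (o , o∈O)) with strong O (proj₁ ∘ proj₁) o∈O (inside (here refl))
            (λ z∈O → proj₂ (proj₁ z∈O) (here refl))
        ... | a , b , (a-out , z→a) , (b∈N , b∉O) , a→b with mem? Z b
        ...   | yes (here refl) = asym z→a a→b
        ...   | yes (there b∈)  = ¬ins (a , a-out , inj₁ (z→a , lose b∈ a→b))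
        ...   | no b∉Z          = ¬pair
            (a , b , (a-out , b∈N , b∉Z) , z→a , a→b , connex (λ { refl → b∉Z (here refl) }) λ z→b → b∉O
            ((b∈N , b∉Z) , z→b))
        blocked (no ¬O) with strong Z inside (here refl) x∈N x∉
        ... | a , b , a∈Z , b-out@(b∈N , b∉Z) , a→b with connex (λ { refl → b∉Z (here refl) })
            (λ z→b → ¬O (b , b-out , z→b))
        ...   | b→z with a∈Z
        ...     | here refl = asym a→b b→z
        ...     | there a∈  = ¬ins (b , b-out , inj₂ (b→z , lose a∈ a→b))

    hamiltonian-cycle : ∀ {z} → z ∈ˢ N → ∃[ zs ] (Cycle z zs × (∀ {x} → x ∈ˢ N → x ∈ z ∷ zs))
    hamiltonian-cycle {z} z∈N = loop n [] record
        { unique = [] ∷ [] ; inside = λ { (here refl) → z∈N } ; closed = inj₁ refl } (m≤n+m n 0)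
      where
      loop : ∀ m zs → Cycle z zs → n ≤ length zs + m → ∃[ zs ] (Cycle z zs × (∀ {x} → x ∈ˢ N → x ∈ z ∷ zs))
      loop m zs cyc bound = choose m bound (any? λ x → mem? (N ∩ ∁ ⟦ z ∷ zs ⟧) x)
        where
        choose : ∀ m → n ≤ length zs + m → Dec (∃[ x ] x ∈ˢ N ∩ ∁ ⟦ z ∷ zs ⟧) → ∃[ zs ]
            (Cycle z zs × (∀ {x} → x ∈ˢ N → x ∈ z ∷ zs))
        choose _ _ (no ¬out) = zs , cyc , λ {x} x∈N → decidable-stable (x ∈? (z ∷ zs)) λ x∉ → ¬out
            (x , x∈N , x∉)
        choose zero bound (yes _) = contradiction (≤-trans (length-unique (Cycle.unique cyc)) bound)
          (<⇒≱ (s≤s (≤-reflexive (+-identityʳ (length zs)))))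
        choose (suc m) bound (yes (x , x∈N , x∉)) with lengthen cyc x∈N x∉
        ... | zs′ , cyc′ , longer = loop m zs′ cyc′
            (≤-trans bound (≤-trans (≤-reflexive (+-suc (length zs) m)) (+-monoˡ-≤ m longer)))

  -- Opening a cycle at a suitable arc

  private
    not-both : ∀ {X Y : Set} (x : Dec X) (y : Dec Y) → ¬ (X × Y) → 𝟙 x + 𝟙 y ≤ 1
    not-both (yes x) (yes y) ¬xy = ⊥-elim (¬xy (x , y))
    not-both (yes _) (no _)  _   = ≤-refl
    not-both (no _)  (yes _) _   = ≤-refl
    not-both (no _)  (no _)  _   = z≤n

    interchange : ∀ a b c d → (a + b) + (c + d) ≡ (a + c) + (b + d)
    interchange = solve-∀

  -- Pigeonhole over the arcs of the cycle, used with `p = z`: each vertex is once a tail, in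
  -- `p ∷ zs`, and once a head, in `zs ++ [ z ]`. Unless some arc has its tail in `B` and its head
  -- in `A`, every arc contributes at most one. Deleting such an arc leaves a path from `A` to `B`.
  cut : ∀ (A B : VSet n) p zs z →
    (∃[ l ] ∃[ r ] (zs ≡ l ++ r × final p l ∈ˢ B × head-or r z ∈ˢ A)) ⊎ count B (p ∷ zs) + count A
        (zs ++ [ z ]) ≤ suc (length zs)
  cut A B p zs z with mem? B p ×-dec mem? A (head-or zs z)
  ... | yes (p∈B , h∈A) = inj₁ ([] , zs , refl , p∈B , h∈A)
  cut A B p []       z | no ¬both = inj₂ (≤-trans (≤-reflexive (interchange (𝟙 (mem? B p)) 0 (𝟙 (mem? A z)) 0))
    (+-monoˡ-≤ 0 (not-both (mem? B p) (mem? A z) ¬both)))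
  cut A B p (q ∷ qs) z | no ¬both with cut A B q qs z
  ... | inj₁ (l , r , eq , e∈B , h∈A) = inj₁ (q ∷ l , r , cong (q ∷_) eq , e∈B , h∈A)
  ... | inj₂ bound = inj₂ (≤-trans
      (≤-reflexive (interchange (𝟙 (mem? B p)) (count B (q ∷ qs)) (𝟙 (mem? A q)) (count A (qs ++ [ z ]))))
    (+-mono-≤ (not-both (mem? B p) (mem? A q) ¬both) bound))

  linked-prefix : ∀ z l {w} → Linked _⟶_ (z ∷ l ++ w) → Linked _⟶_ (z ∷ l)
  linked-prefix z []      l         = [-]
  linked-prefix z (_ ∷ _) (z→q ∷ l) = z→q ∷ linked-prefix _ _ l

  linked-suffix : ∀ l {w} → Linked _⟶_ (l ++ w) → Linked _⟶_ w
  linked-suffix []       l = l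
  linked-suffix (_ ∷ qs) l = linked-suffix qs (Linked.tail l)

  join : ∀ {s z w} r → s ⟶ head-or r z → Linked _⟶_ (r ++ [ z ]) → Linked _⟶_ (z ∷ w) → Linked _⟶_
      (s ∷ r ++ z ∷ w)
  join []           s→z _         l = s→z ∷ l
  join (q ∷ [])     s→q (q→z ∷ _) l = s→q ∷ q→z ∷ l
  join (q ∷ q′ ∷ r) s→q (q→ ∷ lr) l = s→q ∷ join (q′ ∷ r) q→ lr l

  singles : ∀ {Γ} → Unique Γ → (∀ {x} → x ∈ Γ → x ∈ˢ γ) → System u v (map [_] Γ)
  singles {[]}    _           _  = record { nonempty = [] ; linked = [] ; unique = (u≢v ∷ []) ∷ [] ∷ [] }
  singles {x ∷ Γ} (x∉ ∷ uniq) ⊆γ = add-path (singles uniq (⊆γ ∘ there)) (λ ()) (u→x ∷ x→v ∷ [-]) ([] ∷ [])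
      λ { (here refl) → off-ends (arc-≢ u→x ∘ sym) (arc-≢ x→v) λ x∈ → All.lookup x∉
          (subst (x ∈_) (concat-map-[ Γ ]) x∈) refl }
    where
    u→x : u ⟶ x
    u→x = proj₁ (⊆γ (here refl))
    x→v : x ⟶ v
    x→v = proj₂ (⊆γ (here refl))

  -- The case of large `γ`

  module _ {g : V} {Γ : List V} (uniq : Unique (g ∷ Γ)) (⊆γ : ∀ {x} → x ∈ g ∷ Γ → x ∈ˢ γ)
           (Γ≤t : suc (length Γ) ≤ t) (more : suc (2 * suc (length Γ) + ∣ C ∣ˢ) ≤ 2 * ∣ γ ∣ˢ) where

    fs : List V
    fs = u ∷ v ∷ g ∷ Γ

    fs≤ : length fs ≤ 2 * t
    fs≤ = ≤-trans (+-mono-≤ t≥2 Γ≤t) (≤-reflexive (cong (t +_) (sym (+-identityʳ t))))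

    M : VSet n
    M = N fs fs≤

    away : ∀ {x} → x ≢ u → x ≢ v → x ∉ˢ γ → x ∈ˢ M
    away x≢u x≢v x∉γ = off-ends x≢u x≢v (x∉γ ∘ ⊆γ)

    C⊆M : ∀ {x} → x ∈ˢ C → x ∈ˢ M
    C⊆M (v→x , x→u) = away (arc-≢ x→u) (arc-≢ v→x ∘ sym) λ { (u→x , _) → asym u→x x→u }

    -- The vertices of `Γ` become one-vertex paths. If `P` does not use `g`, that vertex stays
    -- outside and is left to `complete`, since it lies in N⁺u.
    system : ∀ {P s zs} → P ≢ [] → Linked _⟶_ (u ∷ P ++ [ v ]) → P ↭ s ++ zs → s ≡ [] ⊎ s ≡ [ g ] →
      Unique zs → (∀ {x} → x ∈ zs → x ∈ˢ M) → (∀ {x} → x ∈ˢ M → x ∈ zs) →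
      ∃[ ss ] (System u v ss × Covers ss × length ss ≡ suc (length Γ))
    system {P} {s} {zs} P≢[] l perm s-small zs-unique zs⊆M M⊆zs =
      P ∷ map [_] Γ , add-path (singles (tail-unique uniq) (⊆γ ∘ there)) P≢[] l
          (Unique-resp-↭ (↭-sym perm) sz-unique) fresh ,
      (λ x x∈C → ∈-++⁺ˡ (∈-resp-↭ (↭-sym perm) (∈-++⁺ʳ s (M⊆zs (C⊆M x∈C))))) , cong suc (length-map [_] Γ)
      where
      tail-unique : ∀ {x : V} {xs} → Unique (x ∷ xs) → Unique xs
      tail-unique (_ ∷ uniq) = uniq
      head-fresh : ∀ {x : V} {xs} → Unique (x ∷ xs) → x ∉ xs
      head-fresh (x∉ ∷ _) x∈ = All.lookup x∉ x∈ refl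
      g∈γ : g ∈ˢ γ
      g∈γ = ⊆γ (here refl)
      small : ∀ {s} → s ≡ [] ⊎ s ≡ [ g ] → Unique s × (∀ {x} → x ∈ s → x ≡ g)
      small (inj₁ refl) = [] , λ ()
      small (inj₂ refl) = [] ∷ [] , λ { (here x≡g) → x≡g }
      s⊆ : ∀ {x} → x ∈ s → x ≡ g
      s⊆ = proj₂ (small s-small)
      sz-unique : Unique (s ++ zs)
      sz-unique = Unique.++⁺ (proj₁ (small s-small)) zs-unique
          λ { (x∈s , x∈zs) → zs⊆M x∈zs (there (there (here (s⊆ x∈s)))) }
      fresh : ∀ {x} → x ∈ P → x ∉ u ∷ v ∷ concat (map [_] Γ)
      fresh {x} x∈P with ∈-++⁻ s (∈-resp-↭ perm x∈P)
      ... | inj₂ x∈zs = off-ends (zs⊆M x∈zs ∘ here) (zs⊆M x∈zs ∘ there ∘ here)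
        λ x∈ → zs⊆M x∈zs (there (there (there (subst (x ∈_) (concat-map-[ Γ ]) x∈))))
      ... | inj₁ x∈s with refl ← s⊆ x∈s = off-ends (arc-≢ (proj₁ g∈γ) ∘ sym) (arc-≢ (proj₂ g∈γ))
        λ x∈ → head-fresh uniq (subst (x ∈_) (concat-map-[ Γ ]) x∈)

    -- `A₁` holds the vertices at which a path can begin when `g` may be put in front, `B₂` those at
    -- which it can end when `g` may be put behind. Since `g` can serve one end only, each is paired
    -- with a set for the other end that makes no use of `g`.
    γ′ C⁺ C⁻ A₁ B₁ A₂ B₂ : VSet n
    γ′ = γ ∩ ∁ ⟦ g ∷ Γ ⟧
    C⁺ = C ∩ Out g
    C⁻ = C ∩ In g
    A₁ = M ∩ (Out u ∪ C⁺)
    B₁ = M ∩ In v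
    A₂ = M ∩ Out u
    B₂ = M ∩ (In v ∪ C⁻)

    γ′⊆M : ∀ {x} → x ∈ˢ γ′ → x ∈ˢ M
    γ′⊆M ((u→x , x→v) , x∉) = off-ends (arc-≢ u→x ∘ sym) (arc-≢ x→v) x∉
    α⊆M : ∀ {x} → x ∈ˢ α → x ∈ˢ M
    α⊆M (u→x , v→x) = away (arc-≢ u→x ∘ sym) (arc-≢ v→x ∘ sym) λ { (_ , x→v) → asym v→x x→v }
    β⊆M : ∀ {x} → x ∈ˢ β → x ∈ˢ M
    β⊆M (x→u , x→v) = away (arc-≢ x→u) (arc-≢ x→v) λ { (u→x , _) → asym u→x x→u }

    γ-bound : ∣ γ ∣ˢ ≤ ∣ γ′ ∣ˢ + suc (length Γ)
    γ-bound = ≤-trans (card-cover γ γ′ ⟦ g ∷ Γ ⟧ split) (+-monoʳ-≤ ∣ γ′ ∣ˢ (card-list (g ∷ Γ)))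
      where
      split : ∀ {x} → x ∈ˢ γ → x ∈ˢ γ′ ⊎ x ∈ g ∷ Γ
      split {x} x∈γ with x ∈? (g ∷ Γ)
      ... | yes x∈ = inj₂ x∈
      ... | no x∉  = inj₁ (x∈γ , x∉)

    start : ∃[ z ] z ∈ˢ γ′
    start = card-nonempty γ′ (≰⇒> λ γ′≤0 → ≤-⊥ ∣ C ∣ˢ
        (+-mono-≤ more (*-monoʳ-≤ 2 (≤-trans γ-bound (+-monoˡ-≤ (suc (length Γ)) γ′≤0))))
            (eq (length Γ) ∣ C ∣ˢ ∣ γ ∣ˢ))
      where
      eq : ∀ w c g → 1 + (2 * (1 + w) + c) + 2 * g ≡ 2 * g + 2 * (0 + (1 + w)) + 1 + c
      eq = solve-∀

    -- Every c ∈ C is joined to g in one direction, so the sizes of A₁, B₁, A₂ and B₂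
    -- add up to at least 2 ∣ α ∣ + 2 ∣ β ∣ + 4 ∣ γ′ ∣ + ∣ C ∣, which exceeds 2 ∣ M ∣.
    too-few : ∀ {z zs} → Cycle fs fs≤ z zs → (∀ {x} → x ∈ˢ M → x ∈ z ∷ zs) →
      count B₁ (z ∷ zs) + count A₁ (zs ++ [ z ]) ≤ suc (length zs) →
      count B₂ (z ∷ zs) + count A₂ (zs ++ [ z ]) ≤ suc (length zs) → ⊥
    too-few {z} {zs} cyc M⊆ fail₁ fail₂ = ≤-⊥ 0
        (+-mono-≤ (+-mono-≤ (+-mono-≤ (≤-trans (+-mono-≤ b₁ a₁) fail₁) (≤-trans (+-mono-≤ b₂ a₂) fail₂))
            (+-mono-≤ (*-monoʳ-≤ 2 len) (*-monoʳ-≤ 2 all-vertices)))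
          (+-mono-≤ (+-mono-≤ (*-monoʳ-≤ 4 γ-bound) C-bound) more))
        (eq n ∣ α ∣ˢ ∣ β ∣ˢ ∣ γ ∣ˢ ∣ C ∣ˢ ∣ γ′ ∣ˢ ∣ C⁺ ∣ˢ ∣ C⁻ ∣ˢ (length zs) (length Γ))
      where
      shifted : ∀ {x} → x ∈ˢ M → x ∈ zs ++ [ z ]
      shifted x∈M with M⊆ x∈M
      ... | here refl = ∈-++⁺ʳ zs (here refl)
      ... | there x∈  = ∈-++⁺ˡ x∈
      a₁ : ∣ α ∣ˢ + (∣ γ′ ∣ˢ + ∣ C⁺ ∣ˢ) ≤ count A₁ (zs ++ [ z ])
      a₁ = ≤-trans (+-monoʳ-≤ ∣ α ∣ˢ (card-∪ γ′ C⁺ λ { ((u→x , _) , _) ((_ , x→u) , _) → asym u→x x→u }))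
        (≤-trans (card-disjoint α (γ′ ∪ C⁺) A₁ (λ x∈α → α⊆M x∈α , inj₁ (proj₁ x∈α))
            (λ { (inj₁ x∈γ′) → γ′⊆M x∈γ′ , inj₁ (proj₁ (proj₁ x∈γ′)) ; (inj₂ x∈C⁺) → C⊆M (proj₁ x∈C⁺) ,
                inj₂ x∈C⁺ })
            (λ { (_ , v→x) (inj₁ ((_ , x→v) , _)) → asym v→x x→v ; (u→x , _) (inj₂ ((_ , x→u) , _)) →
                asym u→x x→u }))
          (card-≤count A₁ (zs ++ [ z ]) (shifted ∘ proj₁)))
      b₁ : ∣ β ∣ˢ + ∣ γ′ ∣ˢ ≤ count B₁ (z ∷ zs)
      b₁ = ≤-trans (card-disjoint β γ′ B₁ (λ x∈β → β⊆M x∈β , proj₂ x∈β)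
          (λ x∈γ′ → γ′⊆M x∈γ′ , proj₂ (proj₁ x∈γ′))
            λ { (x→u , _) ((u→x , _) , _) → asym u→x x→u }) (card-≤count B₁ (z ∷ zs) (M⊆ ∘ proj₁))
      a₂ : ∣ α ∣ˢ + ∣ γ′ ∣ˢ ≤ count A₂ (zs ++ [ z ])
      a₂ = ≤-trans (card-disjoint α γ′ A₂ (λ x∈α → α⊆M x∈α , proj₁ x∈α)
          (λ x∈γ′ → γ′⊆M x∈γ′ , proj₁ (proj₁ x∈γ′))
            λ { (_ , v→x) ((_ , x→v) , _) → asym v→x x→v }) (card-≤count A₂ (zs ++ [ z ]) (shifted ∘ proj₁))
      b₂ : ∣ β ∣ˢ + (∣ γ′ ∣ˢ + ∣ C⁻ ∣ˢ) ≤ count B₂ (z ∷ zs)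
      b₂ = ≤-trans (+-monoʳ-≤ ∣ β ∣ˢ (card-∪ γ′ C⁻ λ { ((u→x , _) , _) ((_ , x→u) , _) → asym u→x x→u }))
        (≤-trans (card-disjoint β (γ′ ∪ C⁻) B₂ (λ x∈β → β⊆M x∈β , inj₁ (proj₂ x∈β))
            (λ { (inj₁ x∈γ′) → γ′⊆M x∈γ′ , inj₁ (proj₂ (proj₁ x∈γ′)) ; (inj₂ x∈C⁻) → C⊆M (proj₁ x∈C⁻) ,
                inj₂ x∈C⁻ })
            (λ { (x→u , _) (inj₁ ((u→x , _) , _)) → asym u→x x→u ; (_ , x→v) (inj₂ ((v→x , _) , _)) →
                asym v→x x→v }))
          (card-≤count B₂ (z ∷ zs) (M⊆ ∘ proj₁)))
      C-bound : ∣ C ∣ˢ ≤ ∣ C⁺ ∣ˢ + ∣ C⁻ ∣ˢ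
      C-bound = card-cover C C⁺ C⁻ split
        where
        split : ∀ {x} → x ∈ˢ C → x ∈ˢ C⁺ ⊎ x ∈ˢ C⁻
        split {x} x∈C with total {g} {x} (λ { refl → asym (proj₁ (⊆γ (here refl))) (proj₂ x∈C) })
        ... | inj₁ g→x = inj₁ (x∈C , g→x)
        ... | inj₂ x→g = inj₂ (x∈C , x→g)
      fs-unique : Unique fs
      fs-unique = (u≢v ∷ All.tabulate (λ x∈ → arc-≢ (proj₁ (⊆γ x∈)))) ∷ All.tabulate
          (λ { x∈ refl → noLoop (proj₂ (⊆γ x∈)) }) ∷ uniq
      len : length fs + suc (length zs) ≤ n
      len = ≤-trans (≤-reflexive (sym (length-++ fs))) (length-unique
        (Unique.++⁺ fs-unique (Cycle.unique cyc) λ { (x∈fs , x∈) → Cycle.inside cyc x∈ x∈fs }))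
      eq : ∀ n a b g c g′ p m z w →
        (b + g′ + (a + (g′ + p))) + (b + (g′ + m) + (a + g′)) + (2 * (3 + w + (1 + z)) + 2 * n) +
            (4 * g + c + (1 + (2 * (1 + w) + c)))
        ≡ (1 + z) + (1 + z) + (2 * n + 2 * (2 + (a + b + (g + c)))) +
            (4 * (g′ + (1 + w)) + (p + m) + 2 * g) + 1 + 0
      eq = solve-∀

    Found : Set
    Found = ∃[ ss ] (System u v ss × Covers ss × length ss ≡ suc (length Γ))

    module _ {z zs} (cyc : Cycle fs fs≤ z zs) (M⊆ : ∀ {x} → x ∈ˢ M → x ∈ z ∷ zs) l r (zs≡ : zs ≡ l ++ r) where

      body : List V
      body = r ++ z ∷ l

      body-perm : body ↭ z ∷ zs
      body-perm = ↭-trans (shift z r l) (prep z (↭-trans (++-comm r l) (↭-reflexive (sym zs≡))))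

      body-linked : ∀ {s e w} → s ⟶ head-or r z → final z l ⟶ e → Linked _⟶_ (e ∷ w) → Linked _⟶_
          (s ∷ body ++ e ∷ w)
      body-linked {s} {e} {w} s→ →e le = subst (λ q → Linked _⟶_ (s ∷ q)) (sym (++-assoc r (z ∷ l) (e ∷ w)))
        (join r s→ suffix (append z l prefix (→e ∷ le)))
        where
        -- The one-vertex cycle has no closing arc and is treated apart.
        halves : Linked _⟶_ (z ∷ l) × Linked _⟶_ (r ++ [ z ])
        halves = [ (λ zs≡[] → trivial (trans (sym zs≡) zs≡[])) , cut-open ]′ (Cycle.closed cyc)
          where
          trivial : l ++ r ≡ [] → Linked _⟶_ (z ∷ l) × Linked _⟶_ (r ++ [ z ])
          trivial eq rewrite ++-conicalˡ l r eq | ++-conicalʳ l r eq = [-] , [-]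
          cut-open : Linked _⟶_ (z ∷ zs ++ [ z ]) → Linked _⟶_ (z ∷ l) × Linked _⟶_ (r ++ [ z ])
          cut-open c = linked-prefix z l c′ , linked-suffix l (Linked.tail c′)
            where
            c′ : Linked _⟶_ (z ∷ l ++ r ++ [ z ])
            c′ = subst (λ q → Linked _⟶_ (z ∷ q)) (trans (cong (_++ [ z ]) zs≡) (++-assoc l r [ z ])) c
        prefix = proj₁ halves
        suffix = proj₂ halves

      done : ∀ {P s} → z ∈ P → Linked _⟶_ (u ∷ P ++ [ v ]) → P ↭ s ++ z ∷ zs → s ≡ [] ⊎ s ≡ [ g ] → Found
      done z∈P l perm s-small = system (λ { refl → contradiction z∈P λ () }) l perm s-small (Cycle.unique cyc)
          (Cycle.inside cyc) M⊆

      z∈body : z ∈ body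
      z∈body = ∈-++⁺ʳ r (here refl)

      plain : u ⟶ head-or r z → final z l ⟶ v → Found
      plain u→ →v = done {s = []} z∈body (body-linked u→ →v [-]) body-perm (inj₁ refl)

      g-first : g ⟶ head-or r z → final z l ⟶ v → Found
      g-first g→ →v = done {s = [ g ]} (there z∈body) (proj₁ (⊆γ (here refl)) ∷ body-linked g→ →v [-])
          (prep g body-perm) (inj₂ refl)

      g-last : u ⟶ head-or r z → final z l ⟶ g → Found
      g-last u→ →g = done {body ++ [ g ]} {[ g ]} (∈-++⁺ˡ z∈body)
        (subst (λ q → Linked _⟶_ (u ∷ q)) (sym (++-assoc body [ g ] [ v ]))
            (body-linked u→ →g (proj₂ (⊆γ (here refl)) ∷ [-])))
        (↭-trans (↭-sym (∷↭∷ʳ g body)) (prep g body-perm)) (inj₂ refl)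

    CutAt : VSet n → VSet n → V → List V → Set
    CutAt A B z zs = ∃[ l ] ∃[ r ] (zs ≡ l ++ r × final z l ∈ˢ B × head-or r z ∈ˢ A)

    from-cuts : ∀ {z zs} → Cycle fs fs≤ z zs → (∀ {x} → x ∈ˢ M → x ∈ z ∷ zs) →
      CutAt A₁ B₁ z zs ⊎ count B₁ (z ∷ zs) + count A₁ (zs ++ [ z ]) ≤ suc (length zs) →
      CutAt A₂ B₂ z zs ⊎ count B₂ (z ∷ zs) + count A₂ (zs ++ [ z ]) ≤ suc (length zs) → Found
    from-cuts cyc M⊆ (inj₁ (l , r , eq , (_ , →v) , _ , inj₁ u→)) _ = plain cyc M⊆ l r eq u→ →v
    from-cuts cyc M⊆ (inj₁ (l , r , eq , (_ , →v) , _ , inj₂ (_ , g→))) _ = g-first cyc M⊆ l r eq g→ →v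
    from-cuts cyc M⊆ (inj₂ _) (inj₁ (l , r , eq , (_ , inj₁ →v) , _ , u→)) = plain cyc M⊆ l r eq u→ →v
    from-cuts cyc M⊆ (inj₂ _) (inj₁ (l , r , eq , (_ , inj₂ (_ , →g)) , _ , u→)) = g-last cyc M⊆ l r eq u→ →g
    from-cuts cyc M⊆ (inj₂ fail₁) (inj₂ fail₂) = ⊥-elim (too-few cyc M⊆ fail₁ fail₂)

    many′ : Found
    many′ = from-cycle (hamiltonian-cycle fs fs≤ (γ′⊆M (proj₂ start)))
      where
      z : V
      z = proj₁ start
      from-cycle : ∃[ zs ] (Cycle fs fs≤ z zs × (∀ {x} → x ∈ˢ M → x ∈ z ∷ zs)) → Found
      from-cycle (zs , cyc , M⊆) = from-cuts cyc M⊆ (cut A₁ B₁ z zs z) (cut A₂ B₂ z zs z)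

  many : ∀ ω → 1 ≤ ω → ω ≤ t → suc (2 * ω + ∣ C ∣ˢ) ≤ 2 * ∣ γ ∣ˢ → ∃[ ss ]
      (System u v ss × Covers ss × length ss ≡ ω)
  many ω ω≥1 ω≤t more = pick (take ω (elements γ)) refl len
    where
    len : length (take ω (elements γ)) ≡ ω
    len = trans (length-take ω (elements γ)) (m≤n⇒m⊓n≡m (≤-trans
      (*-cancelˡ-≤ 2 (≤-trans (m≤m+n (2 * ω) ∣ C ∣ˢ) (≤-trans (n≤1+n _) more)))
          (≤-reflexive (sym (length-elements γ)))))
    uniq : Unique (take ω (elements γ))
    uniq = Unique.take⁺ ω (Unique.filter⁺ (mem? γ) (Unique.allFin⁺ n))
    ⊆γ : ∀ {x} → x ∈ take ω (elements γ) → x ∈ˢ γ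
    ⊆γ = All.lookup (All.take⁺ ω (All.all-filter (mem? γ) (allFin n)))
    pick : ∀ xs → take ω (elements γ) ≡ xs → length (take ω (elements γ)) ≡ ω → ∃[ ss ]
        (System u v ss × Covers ss × length ss ≡ ω)
    pick [] eq len with refl ← trans (sym len) (cong length eq) = contradiction ω≥1 λ ()
    pick (g ∷ Γ) eq len = resize (many′ (subst Unique eq uniq) (λ {x} x∈ → ⊆γ (subst (x ∈_) (sym eq) x∈))
        (subst (_≤ t) ω≡ ω≤t) (subst (λ w → suc (2 * w + ∣ C ∣ˢ) ≤ 2 * ∣ γ ∣ˢ) ω≡ more))
      where
      ω≡ : ω ≡ suc (length Γ)
      ω≡ = trans (sym len) (cong length eq)
      resize : ∃[ ss ] (System u v ss × Covers ss × length ss ≡ suc (length Γ)) → ∃[ ss ]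
          (System u v ss × Covers ss × length ss ≡ ω)
      resize (ss , sys , cov , l) = ss , sys , cov , trans l (sym ω≡)

  spanning : ∀ ω → 1 ≤ ω → ω ≤ t → ∣ C ∣ˢ ≤ ∣ γ ∣ˢ → Container D ω u v
  spanning ω ω≥1 ω≤t C≤γ = finish (choose (2 * ∣ γ ∣ˢ ≤? 2 * ω + ∣ C ∣ˢ))
    where
    choose : Dec (2 * ∣ γ ∣ˢ ≤ 2 * ω + ∣ C ∣ˢ) → ∃[ ss ] (System u v ss × Covers ss × length ss ≡ ω)
    choose (yes γ≤) = few ω ω≤t C≤γ γ≤ ω≥1
    choose (no γ≰)  = many ω ω≥1 ω≤t (≰⇒> γ≰)
    finish : ∃[ ss ] (System u v ss × Covers ss × length ss ≡ ω) → Container D ω u v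
    finish (ss , sys , cov , refl) = complete sys ω≥1 λ v→x x→u → cov _ (v→x , x→u)

-- Exhaustive search and the exact value of κₛ*

cons : ∀ {X : Set} {k} → X → (Fin k → X) → Fin (suc k) → X
cons x f zero    = x
cons x f (suc i) = f i

-- `P` has to respect pointwise equality because a function is compared with its rebuilding by
-- `cons`, which agrees with it only pointwise.
search : ∀ {X : Set} (xs : List X) k {P : (Fin k → X) → Set} → (∀ f → Dec (P f)) →
  (∀ {f g} → (∀ i → f i ≡ g i) → P f → P g) → Dec (∃[ f ] ((∀ i → f i ∈ xs) × P f))
search {X} xs zero P? resp = map′ (λ p → none , (λ ()) , p) (λ { (f , _ , p) → resp {f} {none} (λ ()) p })
    (P? none)
  where
  none : Fin zero → X
  none ()
search xs (suc k) {P} P? resp = map′ to from (Any.any? (λ x → search xs k (P? ∘ cons x) (resp ∘ cons-cong)) xs)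
  where
  cons-cong : ∀ {x f g} → (∀ i → f i ≡ g i) → ∀ i → cons x f i ≡ cons x g i
  cons-cong f≗g zero    = refl
  cons-cong f≗g (suc i) = f≗g i
  to : Any (λ x → ∃[ f ] ((∀ i → f i ∈ xs) × P (cons x f))) xs → ∃[ f ] ((∀ i → f i ∈ xs) × P f)
  to any with find any
  ... | x , x∈ , f , f∈ , p = cons x f , (λ { zero → x∈ ; (suc i) → f∈ i }) , p
  from : ∃[ f ] ((∀ i → f i ∈ xs) × P f) → Any (λ x → ∃[ f ] ((∀ i → f i ∈ xs) × P (cons x f))) xs
  from (f , f∈ , p) = lose (f∈ zero) (f ∘ suc , f∈ ∘ suc , resp (λ { zero → refl ; (suc i) → refl }) p)

lists : ∀ n → ℕ → List (List (Fin n))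
lists n zero    = [ [] ]
lists n (suc m) = [] ∷ cartesianProductWith _∷_ (allFin n) (lists n m)

∈-lists : ∀ {n} m xs → length xs ≤ m → xs ∈ lists n m
∈-lists zero    []       _         = here refl
∈-lists (suc m) []       _         = here refl
∈-lists (suc m) (x ∷ xs) (s≤s xs≤) = there (∈-cartesianProductWith⁺ _∷_ (∈-allFin x) (∈-lists m xs xs≤))

last-∈ : ∀ {A : Set} {v : A} x xs → last (x ∷ xs) ≡ just v → v ∈ x ∷ xs
last-∈ x []       refl = here refl
last-∈ x (y ∷ xs) eq   = there (last-∈ y xs eq)

module _ {n : ℕ} (D : Digraph n) where
  open Digraph D
  open Container

  isPath? : ∀ u v xs → Dec (IsPath D u v xs)
  isPath? u v xs = map′ (λ { (s , e , a , d) → record { starts = s ; ends = e ; arcs = a ; distinct = d } })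
    (λ p → IsPath.starts p , IsPath.ends p , IsPath.arcs p , IsPath.distinct p)
    (Maybe.≡-dec _≟ᶠ_ (head xs) (just u) ×-dec Maybe.≡-dec _≟ᶠ_ (last xs) (just v) ×-dec
     Linked.linked? _⟶?_ xs ×-dec unique? _≟ᶠ_ xs)

  Paths′ : ∀ k u v → (Fin k → List (Fin n)) → Set
  Paths′ k u v f = (∀ i → IsPath D u v (f i)) × (∀ i j → i ≢ j → f i ≢ f j) ×
    (∀ i j → i ≢ j → ∀ x → x ∈ f i → x ∈ f j → x ≡ u ⊎ x ≡ v) × (∀ x → ∃[ i ] x ∈ f i)

  -- The vertices of a path are distinct, so it has length at most `n`, and the candidates are the
  -- `k`-tuples from a finite list.
  container? : ∀ k u v → Dec (Container D k u v)
  container? k u v = map′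
    (λ { (f , _ , p , d , e , s) → record
      { path = f ; isPath = p ; distinct = d _ _ ; disjoint = λ i≢j → e _ _ i≢j _ ; spanning = s } })
    (λ c → path c , (λ i → ∈-lists n (path c i) (length-unique (IsPath.distinct (isPath c i)))) ,
      isPath c , (λ _ _ → distinct c) , (λ _ _ i≢j _ → disjoint c i≢j) , spanning c)
    (search (lists n n) k {Paths′ k u v}
      (λ f → all? (λ i → isPath? u v (f i)) ×-dec
        all? (λ i → all? λ j → ¬? (i ≟ᶠ j) →-dec ¬? (≡-dec _≟ᶠ_ (f i) (f j))) ×-dec
        all? (λ i → all? λ j → ¬? (i ≟ᶠ j) →-dec all? λ x → (x ∈? f i) →-dec
            ((x ∈? f j) →-dec ((x ≟ᶠ u) ⊎-dec (x ≟ᶠ v)))) ×-dec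
        all? (λ x → any? λ i → x ∈? f i))
      λ { f≗g (p , d , e , s) →
        (λ i → subst (IsPath D u v) (f≗g i) (p i)) ,
        (λ i j i≢j g≡ → d i j i≢j (trans (f≗g i) (trans g≡ (sym (f≗g j))))) ,
        (λ i j i≢j x x∈ x∈′ → e i j i≢j x (subst (x ∈_) (sym (f≗g i)) x∈) (subst (x ∈_) (sym (f≗g j)) x∈′)) ,
        (λ x → proj₁ (s x) , subst (x ∈_) (f≗g (proj₁ (s x))) (proj₂ (s x))) })

  stronglyConnected? : ∀ k → Dec (StronglyConnected* D k)
  stronglyConnected? k = map′ (λ h {u} {v} → h u v) (λ h u v → h)
    (all? λ u → all? λ v → ¬? (u ≟ᶠ v) →-dec (container? k u v ⊎-dec container? k v u))

  -- The second vertices of the paths are pairwise distinct.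
  container-bound : ∀ {k u v} → u ≢ v → Container D k u v → k ≤ n
  container-bound {k} {u} {v} u≢v c = injective⇒≤ {f = proj₁ ∘ second} injective
    where
    Second : List (Fin n) → Set
    Second xs = ∃[ x ] ∃[ r ] xs ≡ u ∷ x ∷ r
    from-path : ∀ xs → IsPath D u v xs → Second xs
    from-path [] p with () ← IsPath.starts p
    from-path (a ∷ []) p = contradiction
        (trans (sym (just-injective (IsPath.starts p))) (just-injective (IsPath.ends p))) u≢v
    from-path (a ∷ x ∷ r) p = x , r , cong (_∷ x ∷ r) (just-injective (IsPath.starts p))
    second : ∀ i → Second (path c i)
    second i = from-path (path c i) (isPath c i)
    short : ∀ {xs} → IsPath D u v xs → ∀ r → xs ≡ u ∷ v ∷ r → r ≡ []
    short p []      _    = refl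
    short p (q ∷ r) refl with _ ∷ v∉ ∷ _ ← IsPath.distinct p = ⊥-elim
        (All.lookup v∉ (last-∈ q r (IsPath.ends p)) refl)
    second-≢u : ∀ {xs x r} → IsPath D u v xs → xs ≡ u ∷ x ∷ r → x ≢ u
    second-≢u p refl refl with (u≢u ∷ _) ∷ _ ← IsPath.distinct p = u≢u refl
    injective : ∀ {i j} → proj₁ (second i) ≡ proj₁ (second j) → i ≡ j
    injective {i} {j} eq with i ≟ᶠ j
    ... | yes i≡j = i≡j
    ... | no i≢j with second i | second j | eq
    ...   | x , r , eqᵢ | .x , r′ , eqⱼ | refl
      with disjoint c i≢j (subst (x ∈_) (sym eqᵢ) (there (here refl)))
          (subst (x ∈_) (sym eqⱼ) (there (here refl)))
    ...     | inj₁ x≡u  = ⊥-elim (second-≢u (isPath c i) eqᵢ x≡u)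
    -- A shared second vertex `v` makes both paths the arc `u ⟶ v`, which only the distinctness of
    -- the paths excludes.
    ...     | inj₂ refl = ⊥-elim (distinct c i≢j (trans eqᵢ (trans
      (cong (λ r → u ∷ v ∷ r) (trans (short (isPath c i) r eqᵢ) (sym (short (isPath c j) r′ eqⱼ)))) (sym eqⱼ))))

  connectivity-bound : ∀ {u v} → u ≢ v → ∀ k → StronglyConnected*UpTo D k → k ≤ n
  connectivity-bound u≢v zero    _  = z≤n
  connectivity-bound u≢v (suc k) up = [ container-bound u≢v , container-bound (u≢v ∘ sym) ]′
      (up (suc k) (s≤s z≤n) ≤-refl u≢v)

  -- The value is raised from `t` as long as the next one is attained, and `connectivity-bound` ends
  -- this. The first failure bounds every `k`, because `StronglyConnected*UpTo` demands all smaller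
  -- values as well.
  maximal : ∀ {u v} → u ≢ v → ∀ {t} → 1 ≤ t → StronglyConnected*UpTo D t → ∃[ κ ]
      (IsStrongSpanningConnectivity D κ × κ ≥ t)
  maximal u≢v {t} t≥1 up-t = loop n t up-t ≤-refl (m≤n+m n t)
    where
    loop : ∀ m κ → StronglyConnected*UpTo D κ → t ≤ κ → n ≤ κ + m → ∃[ κ ]
        (IsStrongSpanningConnectivity D κ × κ ≥ t)
    loop m κ up t≤κ bound = choose m bound (stronglyConnected? (suc κ))
      where
      choose : ∀ m → n ≤ κ + m → Dec (StronglyConnected* D (suc κ)) → ∃[ κ ]
          (IsStrongSpanningConnectivity D κ × κ ≥ t)
      choose _ _ (no ¬next) = κ , record
        { connected* = up-t 1 ≤-refl t≥1
        ; attained   = up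
        ; largest    = λ k up-k → ≮⇒≥ λ κ<k → ¬next (up-k (suc κ) (s≤s z≤n) κ<k) } , t≤κ
      choose m bound (yes next) = continue m bound
        where
        up′ : StronglyConnected*UpTo D (suc κ)
        up′ ω ω≥1 ω≤ with m≤n⇒m<n∨m≡n ω≤
        ... | inj₁ ω<   = up ω ω≥1 (s≤s⁻¹ ω<)
        ... | inj₂ refl = next
        continue : ∀ m → n ≤ κ + m → ∃[ κ ] (IsStrongSpanningConnectivity D κ × κ ≥ t)
        continue zero    bound = contradiction
            (≤-trans (connectivity-bound u≢v (suc κ) up′) (≤-trans bound (≤-reflexive (+-identityʳ κ)))) 1+n≰n
        continue (suc m) bound = loop m (suc κ) up′ (m≤n⇒m≤1+n t≤κ) (≤-trans bound (≤-reflexive (+-suc κ m)))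

-- From irregularity to degree bounds, and the conclusion

degree-difference : ∀ {n} (D : Digraph n) x → ∣ outdegree D x - indegree D x ∣ ≤ irregularity D
degree-difference D x = All.lookup (xs≤max 0 _) (∈-map⁺ _ (∈-allFin x))

module _ {n : ℕ} (D : Digraph n) (tour : IsTournament D) {k : ℕ} (irr : irregularity D ≤ k) where
  open Tournament D tour

  difference : ∀ x → ∣ ∣ Out x ∣ˢ - ∣ In x ∣ˢ ∣ ≤ k
  difference x = ≤-trans (≤-reflexive
      (cong₂ ∣_-_∣ (sym (length-elements (Out x))) (sym (length-elements (In x)))))
    (≤-trans (degree-difference D x) irr)

  degree-total : ∀ x → n ≤ 1 + (∣ Out x ∣ˢ + ∣ In x ∣ˢ)
  degree-total x = ≤-trans (≤-reflexive (sym card-full))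
      (≤-trans (card-cover full ⟦ [ x ] ⟧ (Out x ∪ In x) split)
    (+-mono-≤ (card-list [ x ]) (card-cover _ (Out x) (In x) id)))
    where
    split : ∀ {y} → y ∈ˢ full → y ∈ [ x ] ⊎ y ∈ˢ Out x ∪ In x
    split {y} _ with y ≟ᶠ x
    ... | yes y≡x = inj₁ (here y≡x)
    ... | no y≢x  = inj₂ (total (y≢x ∘ sym))

  outdegree≥ : ∀ x → n ≤ 1 + k + 2 * ∣ Out x ∣ˢ
  outdegree≥ x = linear n (1 + k + 2 * o) 0
      (+-mono-≤ (degree-total x) (≤-trans (m≤n+∣n-m∣ i o) (+-monoʳ-≤ o (difference x)))) (eq n k o i)
    where
    o = ∣ Out x ∣ˢ
    i = ∣ In x ∣ˢ
    eq : ∀ n k o i → n + i + (1 + k + 2 * o) ≡ 1 + (o + i) + (o + k) + n + 0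
    eq = solve-∀

  indegree≥ : ∀ x → n ≤ 1 + k + 2 * ∣ In x ∣ˢ
  indegree≥ x = linear n (1 + k + 2 * i) 0
      (+-mono-≤ (degree-total x) (≤-trans (m≤n+∣m-n∣ o i) (+-monoʳ-≤ i (difference x)))) (eq n k o i)
    where
    o = ∣ Out x ∣ˢ
    i = ∣ In x ∣ˢ
    eq : ∀ n k o i → n + o + (1 + k + 2 * i) ≡ 1 + (o + i) + (i + k) + n + 0
    eq = solve-∀

distinct-vertices : ∀ {n} → 2 ≤ n → ∃[ u ] ∃[ v ] (_≢_ {A = Fin n} u v)
distinct-vertices (s≤s (s≤s _)) = zero , suc zero , λ ()

theorem4p2 : (k t n : ℕ) → t ≥ 2 → (T : Digraph n) → IsTournament T → irregularity T ≤ k →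
    n ≥ 6 * t + 5 * k →
    (∃[ κ ] (IsStrongSpanningConnectivity T κ × κ ≥ t)) × (∀ ω → 1 ≤ ω → ω ≤ t → StronglyConnected* T ω)
theorem4p2 k t n t≥2 T tour irr n≥ = maximal T (proj₂ (proj₂ (distinct-vertices n≥2)))
    (≤-trans (s≤s z≤n) t≥2) connected , connected
  where
  n≥2 : 2 ≤ n
  n≥2 = ≤-trans (m≤m+n 2 10) (≤-trans (*-monoʳ-≤ 6 t≥2) (≤-trans (m≤m+n (6 * t) (5 * k)) n≥))
  connected : ∀ ω → 1 ≤ ω → ω ≤ t → StronglyConnected* T ω
  connected ω ω≥1 ω≤t {u} {v} u≢v = choose (≤-total ∣ Forward.C ∣ˢ ∣ Forward.γ ∣ˢ)
    where
    module Forward = Between T tour k (outdegree≥ T tour irr) (indegree≥ T tour irr) t t≥2 n≥ u v u≢v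
    module Backward = Between T tour k (outdegree≥ T tour irr) (indegree≥ T tour irr) t t≥2 n≥ v u (u≢v ∘ sym)
    choose : ∣ Forward.C ∣ˢ ≤ ∣ Forward.γ ∣ˢ ⊎ ∣ Forward.γ ∣ˢ ≤ ∣ Forward.C ∣ˢ → StrongContainer T ω u v
    choose (inj₁ C≤γ) = inj₁ (Forward.spanning ω ω≥1 ω≤t C≤γ)
    -- `Backward.C` and `Backward.γ` unfold to `Forward.γ` and `Forward.C`, so `γ≤C` already has the
    -- required form; here all paths run from `v` to `u`.
    choose (inj₂ γ≤C) = inj₂ (Backward.spanning ω ω≥1 ω≤t γ≤C)
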